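{- The number $\pi$ is irrational. -}

module Defs where

open import Data.Nat.Base as ℕ using (ℕ; zero; suc; _!)
import Data.Nat.Properties as ℕ
open import Data.Nat.Properties using (_!≢0)
open import Data.Integer.Base as ℤ using (ℤ)
import Data.Integer.Properties as ℤ
open import Data.Rational.Base
open import Data.Rational.Properties
import Data.Rational.Unnormalised.Base as ℚᵘ
import Data.Rational.Unnormalised.Properties as ℚᵘ
open import Data.Rational.Solver using (module +-*-Solver)
open import Algebra.Definitions.RawSemiring +-*-rawSemiring using (_^_)
open import Data.Product.Base using (_×_; _,_; ∃; ∃-syntax; proj₁; proj₂)
open import Data.Sum.Base using (inj₁; inj₂; [_,_]′)
open import Relation.Nullary.Negation.Core using (¬_)
open import Relation.Nullary.Decidable.Core using (from-yes)
open import Relation.Binary.PropositionalEquality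
  using (_≡_; refl; sym; trans; cong; cong₂; subst; subst₂; module ≡-Reasoning)

open +-*-Solver using (solve; _:=_; _:+_; _:*_; :-_; _:-_; con)

Cauchy : (ℕ → ℚ) → Set
Cauchy u = ∀ ε → 0ℚ < ε → ∃[ N ] ∀ m n → N ℕ.≤ m → N ℕ.≤ n → ∣ u m - u n ∣ < ε

-- Reals are Cauchy sequences of rationals, taken up to _≃ᵣ_.
record ℝ : Set where
  constructor mkℝ
  field
    seq    : ℕ → ℚ
    cauchy : Cauchy seq

open ℝ public

infix 4 _≃ᵣ_ _<ᵣ_

_≃ᵣ_ : ℝ → ℝ → Set
x ≃ᵣ y = ∀ ε → 0ℚ < ε → ∃[ N ] ∀ n → N ℕ.≤ n → ∣ seq x n - seq y n ∣ < ε

_<ᵣ_ : ℝ → ℝ → Set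
x <ᵣ y = ∃[ ε ] 0ℚ < ε × ∃[ N ] ∀ n → N ℕ.≤ n → seq x n + ε < seq y n

-- Most inequalities below are proved by exhibiting the difference of the two
-- sides as an expression that is visibly nonnegative.
0≤⇒≤ : ∀ {p q e} → 0ℚ ≤ e → q - p ≡ e → p ≤ q
0≤⇒≤ {p} {q} {e} 0≤e eq =
  subst (p ≤_) (trans (cong (p +_) (sym eq)) (solve 2 (λ p q → p :+ (q :- p) := q) refl p q))
    (subst (_≤ p + e) (+-identityʳ p) (+-monoʳ-≤ p 0≤e))

≤⇒0≤ : ∀ {p q} → p ≤ q → 0ℚ ≤ q - p
≤⇒0≤ {p} {q} p≤q = subst (_≤ q - p) (+-inverseʳ p) (+-monoˡ-≤ (- p) p≤q)

0≤+ : ∀ {p q} → 0ℚ ≤ p → 0ℚ ≤ q → 0ℚ ≤ p + q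
0≤+ = +-mono-≤

0≤* : ∀ {p q} → 0ℚ ≤ p → 0ℚ ≤ q → 0ℚ ≤ p * q
0≤* {p} {q} 0≤p 0≤q =
  subst (_≤ p * q) (*-zeroʳ p) (*-monoˡ-≤-nonNeg p {{nonNegative 0≤p}} 0≤q)

0<* : ∀ {p q} → 0ℚ < p → 0ℚ < q → 0ℚ < p * q
0<* {p} {q} 0<p 0<q =
  subst (_< p * q) (*-zeroʳ p) (*-monoʳ-<-pos p {{positive 0<p}} 0<q)

*-mono-≤-0≤ : ∀ {p q r s} → 0ℚ ≤ p → 0ℚ ≤ s → p ≤ q → r ≤ s → p * r ≤ q * s
*-mono-≤-0≤ {p} {q} {r} {s} 0≤p 0≤s p≤q r≤s =
  ≤-trans (*-monoˡ-≤-nonNeg p {{nonNegative 0≤p}} r≤s)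
          (*-monoʳ-≤-nonNeg s {{nonNegative 0≤s}} p≤q)

∣∣≤ : ∀ {p q} → p ≤ q → - p ≤ q → ∣ p ∣ ≤ q
∣∣≤ {p} {q} a b with ∣p∣≡p∨∣p∣≡-p p
... | inj₁ e = subst (_≤ q) (sym e) a
... | inj₂ e = subst (_≤ q) (sym e) b

p≤∣p∣ : ∀ p → p ≤ ∣ p ∣
p≤∣p∣ p with ≤-total 0ℚ p
... | inj₁ 0≤p = ≤-reflexive (sym (0≤p⇒∣p∣≡p 0≤p))
... | inj₂ p≤0 = ≤-trans p≤0 (0≤∣p∣ p)

∣-∣-sym : ∀ p q → ∣ p - q ∣ ≡ ∣ q - p ∣
∣-∣-sym p q = trans (sym (∣-p∣≡∣p∣ (p - q)))
  (cong ∣_∣ (solve 2 (λ p q → :- (p :- q) := q :- p) refl p q))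

triangle : ∀ p q r → ∣ p - r ∣ ≤ ∣ p - q ∣ + ∣ q - r ∣
triangle p q r = subst (λ z → ∣ z ∣ ≤ ∣ p - q ∣ + ∣ q - r ∣)
  (solve 3 (λ p q r → (p :- q) :+ (q :- r) := p :- r) refl p q r)
  (∣p+q∣≤∣p∣+∣q∣ (p - q) (q - r))

p<p+q : ∀ p {q} → 0ℚ < q → p < p + q
p<p+q p {q} 0<q = subst (_< p + q) (+-identityʳ p) (+-monoʳ-< p 0<q)

half : ℚ → ℚ
half ε = ½ * ε

half-pos : ∀ {ε} → 0ℚ < ε → 0ℚ < half ε
half-pos = 0<* (from-yes (0ℚ <? ½))

half+half : ∀ ε → half ε + half ε ≡ ε
half+half = solve 1 (λ e → con ½ :* e :+ con ½ :* e := e) refl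

-- A positive η with L * η < ε.
shrink : ∀ {L ε} → 0ℚ ≤ L → 0ℚ < ε → ∃[ η ] 0ℚ < η × L * η < ε
shrink {L} {ε} 0≤L 0<ε = η , 0<η , L*η<ε
  where
  0<L+1 : 0ℚ < L + 1ℚ
  0<L+1 = ≤-<-trans 0≤L (p<p+q L (from-yes (0ℚ <? 1ℚ)))
  instance
    pos-L+1 : Positive (L + 1ℚ)
    pos-L+1 = positive 0<L+1
    nz : NonZero (L + 1ℚ)
    nz = pos⇒nonZero (L + 1ℚ)
  i : ℚ
  i = 1/ (L + 1ℚ)
  η : ℚ
  η = i * ε
  0<η : 0ℚ < η
  0<η = 0<* (positive⁻¹ i {{1/pos⇒pos (L + 1ℚ)}}) 0<ε
  eq : L * η + η ≡ ε
  eq = begin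
    L * (i * ε) + i * ε   ≡⟨ solve 3 (λ l i e → l :* (i :* e) :+ i :* e
                               := (l :+ con 1ℚ) :* i :* e) refl L i ε ⟩
    (L + 1ℚ) * i * ε      ≡⟨ cong (_* ε) (*-inverseʳ (L + 1ℚ)) ⟩
    1ℚ * ε                ≡⟨ *-identityˡ ε ⟩
    ε                     ∎
    where open ≡-Reasoning
  L*η<ε : L * η < ε
  L*η<ε = subst (L * η <_) eq (p<p+q (L * η) 0<η)

toℚᵘ-/ : ∀ n d → toℚᵘ (n / suc d) ℚᵘ.≃ ℚᵘ.mkℚᵘ n d
toℚᵘ-/ n d = toℚᵘ-fromℚᵘ (ℚᵘ.mkℚᵘ n d)

/-*-/ : ∀ a b c d → (a / suc b) * (c / suc d) ≡ (a ℤ.* c) / (suc b ℕ.* suc d)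
/-*-/ a b c d = toℚᵘ-injective
  (ℚᵘ.≃-trans (toℚᵘ-homo-* (a / suc b) (c / suc d))
  (ℚᵘ.≃-trans (ℚᵘ.*-cong (toℚᵘ-/ a b) (toℚᵘ-/ c d))
  (ℚᵘ.≃-sym (toℚᵘ-/ (a ℤ.* c) (d ℕ.+ b ℕ.* suc d)))))

/-≤-/ : ∀ a b c d → a ℕ.* suc d ℕ.≤ c ℕ.* suc b → (ℤ.+ a / suc b) ≤ (ℤ.+ c / suc d)
/-≤-/ a b c d le = toℚᵘ-cancel-≤
  (ℚᵘ.≤-respˡ-≃ (ℚᵘ.≃-sym (toℚᵘ-/ (ℤ.+ a) b))
  (ℚᵘ.≤-respʳ-≃ (ℚᵘ.≃-sym (toℚᵘ-/ (ℤ.+ c) d))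
  (ℚᵘ.*≤* (subst₂ ℤ._≤_ (ℤ.pos-* a (suc d)) (ℤ.pos-* c (suc b)) (ℤ.+≤+ le)))))

ι : ℕ → ℚ
ι n = ℤ.+ n / 1

ι-suc : ∀ n → ι (suc n) ≡ ι n + 1ℚ
ι-suc n = toℚᵘ-injective
  (ℚᵘ.≃-trans (toℚᵘ-/ (ℤ.+ suc n) 0)
  (ℚᵘ.≃-trans (ℚᵘ.*≡* (cong (ℤ._* ℤ.+ 1) (trans (cong ℤ.+_ (ℕ.+-comm 1 n))
    (cong (ℤ._+ ℤ.+ 1) (sym (ℤ.*-identityʳ (ℤ.+ n)))))))
  (ℚᵘ.≃-sym (ℚᵘ.≃-trans (toℚᵘ-homo-+ (ι n) 1ℚ)
    (ℚᵘ.+-congˡ (toℚᵘ 1ℚ) (toℚᵘ-/ (ℤ.+ n) 0))))))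

ι-mono : ∀ {m n} → m ℕ.≤ n → ι m ≤ ι n
ι-mono {m} {n} m≤n = /-≤-/ m 0 n 0 (ℕ.*-monoˡ-≤ 1 m≤n)

0≤ι : ∀ n → 0ℚ ≤ ι n
0≤ι n = ι-mono {0} {n} ℕ.z≤n

≤ι : ∀ q → ∃[ n ] q ≤ ι n
≤ι q@(mkℚ (ℤ.+ a) d _) = a , toℚᵘ-cancel-≤ (ℚᵘ.≤-respʳ-≃ (ℚᵘ.≃-sym (toℚᵘ-/ (ℤ.+ a) 0))
  (ℚᵘ.*≤* (subst₂ ℤ._≤_ (ℤ.pos-* a 1) (ℤ.pos-* a (suc d)) (ℤ.+≤+ (ℕ.*-monoʳ-≤ a (ℕ.s≤s ℕ.z≤n))))))
≤ι q@(mkℚ (ℤ.-[1+ a ]) d _) = 0 , toℚᵘ-cancel-≤ (ℚᵘ.*≤* ℤ.-≤+)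

archimedean : ∀ C {ε} → 0ℚ < ε → ∃[ n ] C < ι n * ε
archimedean C {ε} 0<ε = n , <-≤-trans step
    (*-monoʳ-≤-nonNeg ε {{nonNegative (<⇒≤ 0<ε)}} q+1≤ιn)
  where
  instance
    pos-ε : Positive ε
    pos-ε = positive 0<ε
    nz : NonZero ε
    nz = pos⇒nonZero ε
  q : ℚ
  q = C * 1/ ε
  n = proj₁ (≤ι (q + 1ℚ))
  q+1≤ιn = proj₂ (≤ι (q + 1ℚ))
  eq : C + ε ≡ (q + 1ℚ) * ε
  eq = sym (begin
    (C * 1/ ε + 1ℚ) * ε   ≡⟨ solve 3 (λ c i e → (c :* i :+ con 1ℚ) :* e := c :* (i :* e) :+ e) refl C (1/ ε) ε ⟩
    C * (1/ ε * ε) + ε    ≡⟨ cong (λ z → C * z + ε) (*-inverseˡ ε) ⟩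
    C * 1ℚ + ε            ≡⟨ cong (_+ ε) (*-identityʳ C) ⟩
    C + ε                 ∎)
    where open ≡-Reasoning
  step : C < (q + 1ℚ) * ε
  step = subst (C <_) eq (p<p+q C 0<ε)

5/6 : ℚ
5/6 = ℤ.+ 5 / 6

6ℚ : ℚ
6ℚ = ι 6

0≤1 : 0ℚ ≤ 1ℚ
0≤1 = from-yes (0ℚ ≤? 1ℚ)

module Geometric (E : ℕ → ℚ) (K : ℕ) (0≤E : ∀ n → 0ℚ ≤ E n)
  (E-step : ∀ n → K ℕ.≤ n → E (suc n) ≤ 5/6 * E n) where

  decay : ∀ j → (ι j + ι 5) * E (j ℕ.+ K) ≤ ι 5 * E K
  decay zero = ≤-reflexive (cong (_* E K) (+-identityˡ (ι 5)))
  decay (suc j) = 0≤⇒≤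
    (0≤+ (0≤+ (≤⇒0≤ (decay j))
      (0≤* (0≤+ (0≤ι j) (0≤ι 6)) (≤⇒0≤ (E-step (j ℕ.+ K) (ℕ.m≤n+m K j)))))
      (0≤* (0≤* (0≤ι j) (from-yes (0ℚ ≤? ℤ.+ 1 / 6))) (0≤E (j ℕ.+ K))))
    (trans (cong (λ z → ι 5 * E K - (z + ι 5) * E (suc (j ℕ.+ K))) (ι-suc j))
      (solve 4 (λ a k e e′ → con (ι 5) :* k :- ((a :+ con 1ℚ) :+ con (ι 5)) :* e′
        := (con (ι 5) :* k :- (a :+ con (ι 5)) :* e)
           :+ (a :+ con (ι 6)) :* (con 5/6 :* e :- e′)
           :+ a :* con (ℤ.+ 1 / 6) :* e)
        refl (ι j) (E K) (E (j ℕ.+ K)) (E (suc (j ℕ.+ K)))))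

  null : ∀ {ε} → 0ℚ < ε → ∃[ N ] K ℕ.≤ N × (∀ n → N ℕ.≤ n → 6ℚ * E n < ε)
  null {ε} 0<ε = j₀ ℕ.+ K , ℕ.m≤n+m K j₀ , go
    where
    arch = archimedean (6ℚ * (ι 5 * E K)) 0<ε
    j₀ = proj₁ arch
    go : ∀ n → j₀ ℕ.+ K ℕ.≤ n → 6ℚ * E n < ε
    go n le = *-cancelˡ-<-nonNeg (ι j + ι 5) {{nonNegative (0≤+ (0≤ι j) (0≤ι 5))}}
      (≤-<-trans (0≤⇒≤ (0≤* (0≤ι 6) (≤⇒0≤ (decay′)))
          (solve 3 (λ a e k → con 6ℚ :* (con (ι 5) :* k) :- a :* (con 6ℚ :* e)
            := con 6ℚ :* (con (ι 5) :* k :- a :* e)) refl (ι j + ι 5) (E n) (E K)))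
        (<-≤-trans (proj₂ arch)
          (*-monoʳ-≤-nonNeg ε {{nonNegative (<⇒≤ 0<ε)}}
            (≤-trans (ι-mono (ℕ.m+n≤o⇒m≤o∸n j₀ le))
              (0≤⇒≤ {ι j} {ι j + ι 5} (0≤ι 5) (solve 1 (λ a → (a :+ con (ι 5)) :- a := con (ι 5)) refl (ι j)))))))
      where
      j = n ℕ.∸ K
      decay′ : (ι j + ι 5) * E n ≤ ι 5 * E K
      decay′ = subst (λ z → (ι j + ι 5) * E z ≤ ι 5 * E K)
        (ℕ.m∸n+n≡m (ℕ.≤-trans (ℕ.m≤n+m K j₀) le)) (decay j)

  module _ (u : ℕ → ℚ) (u-step : ∀ n → K ℕ.≤ n → ∣ u (suc n) - u n ∣ ≤ E n) where

    telescope : ∀ n → K ℕ.≤ n → ∀ d → ∣ u (d ℕ.+ n) - u n ∣ ≤ 6ℚ * (E n - E (d ℕ.+ n))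
    telescope n K≤n zero = ≤-reflexive (trans (cong ∣_∣ (+-inverseʳ (u n)))
      (sym (trans (cong (6ℚ *_) (+-inverseʳ (E n))) (*-zeroʳ 6ℚ))))
    telescope n K≤n (suc d) = ≤-trans (triangle (u (suc (d ℕ.+ n))) (u (d ℕ.+ n)) (u n))
      (≤-trans (+-mono-≤ (u-step (d ℕ.+ n) K≤d+n) (telescope n K≤n d))
        (0≤⇒≤ (0≤* (0≤ι 6) (≤⇒0≤ (E-step (d ℕ.+ n) K≤d+n)))
          (solve 3 (λ a e e′ → con 6ℚ :* (a :- e′) :- (e :+ con 6ℚ :* (a :- e))
            := con 6ℚ :* (con 5/6 :* e :- e′)) refl (E n) (E (d ℕ.+ n)) (E (suc (d ℕ.+ n))))))
      where K≤d+n = ℕ.≤-trans K≤n (ℕ.m≤n+m n d)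

    tail : ∀ {N} → K ℕ.≤ N → ∀ n → N ℕ.≤ n → ∣ u n - u N ∣ ≤ 6ℚ * E N
    tail {N} K≤N n N≤n = ≤-trans
      (subst (λ z → ∣ u z - u N ∣ ≤ 6ℚ * (E N - E z)) (ℕ.m∸n+n≡m N≤n) (telescope N K≤N (n ℕ.∸ N)))
      (0≤⇒≤ (0≤* (0≤ι 6) (0≤E n))
        (solve 2 (λ a b → con 6ℚ :* a :- con 6ℚ :* (a :- b) := con 6ℚ :* b) refl (E N) (E n)))

pivot : ∀ u → (∀ ε → 0ℚ < ε → ∃[ N ] ∀ n → N ℕ.≤ n → ∣ u n - u N ∣ < ε) → Cauchy u
pivot u h ε 0<ε with h (half ε) (half-pos 0<ε)
... | N , hN = N , λ m n N≤m N≤n → ≤-<-trans (triangle (u m) (u N) (u n))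
  (subst (∣ u m - u N ∣ + ∣ u N - u n ∣ <_) (half+half ε)
    (+-mono-< (hN m N≤m) (subst (_< half ε) (∣-∣-sym (u n) (u N)) (hN n N≤n))))

cosTerm : ℕ → ℚ → ℚ
cosTerm k q = (- 1ℚ) ^ k * q ^ (2 ℕ.* k) * ((ℤ.+ 1 / (2 ℕ.* k) !) {{(2 ℕ.* k) !≢0}})

partialSum : (ℕ → ℚ) → ℕ → ℚ
partialSum f zero    = 0ℚ
partialSum f (suc n) = partialSum f n + f n

cosSum : ℕ → ℚ → ℚ
cosSum n q = partialSum (λ k → cosTerm k q) n

recip : ℕ → ℚ
recip m = ℤ.+ 1 / suc m

ρ : ℕ → ℚ
ρ k = recip (suc (2 ℕ.* k)) * recip (2 ℕ.* k)

0≤recip : ∀ m → 0ℚ ≤ recip m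
0≤recip m = /-≤-/ 0 0 1 m ℕ.z≤n

recip-anti : ∀ {m n} → m ℕ.≤ n → recip n ≤ recip m
recip-anti {m} {n} m≤n = /-≤-/ 1 n 1 m (ℕ.*-monoʳ-≤ 1 (ℕ.s≤s m≤n))

ι*recip : ∀ m → ι (suc m) * recip m ≡ 1ℚ
ι*recip m = toℚᵘ-injective
  (ℚᵘ.≃-trans (toℚᵘ-homo-* (ι (suc m)) (recip m))
  (ℚᵘ.≃-trans (ℚᵘ.*-cong (toℚᵘ-/ (ℤ.+ suc m) 0) (toℚᵘ-/ (ℤ.+ 1) m))
  (ℚᵘ.*≡* (trans (ℤ.*-identityʳ _) (trans (ℤ.*-identityʳ _)
    (sym (trans (ℤ.*-identityˡ _) (cong ℤ.+_ (ℕ.*-identityˡ (suc m))))))))))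

0≤ρ : ∀ k → 0ℚ ≤ ρ k
0≤ρ k = 0≤* (0≤recip (suc (2 ℕ.* k))) (0≤recip (2 ℕ.* k))

ρ-anti : ∀ {j k} → j ℕ.≤ k → ρ k ≤ ρ j
ρ-anti {j} {k} j≤k = *-mono-≤-0≤ (0≤recip (suc (2 ℕ.* k))) (0≤recip (2 ℕ.* j))
  (recip-anti (ℕ.s≤s le)) (recip-anti le)
  where le = ℕ.*-monoʳ-≤ 2 j≤k

*ρ≤5/6 : ∀ {D k K} → 0ℚ ≤ D → D ≤ ι K → suc K ℕ.≤ k → D * ρ k ≤ 5/6
*ρ≤5/6 {D} {k} {K} 0≤D D≤ιK K<k = begin
  D * (recip (suc (2 ℕ.* k)) * recip (2 ℕ.* k))
    ≡⟨ sym (*-assoc D (recip (suc (2 ℕ.* k))) (recip (2 ℕ.* k))) ⟩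
  D * recip (suc (2 ℕ.* k)) * recip (2 ℕ.* k)
    ≤⟨ *-mono-≤-0≤ (0≤* 0≤D (0≤recip (suc (2 ℕ.* k)))) (0≤recip 1) below₁ (recip-anti 1≤2k) ⟩
  1ℚ * recip 1
    ≤⟨ from-yes (1ℚ * recip 1 ≤? 5/6) ⟩
  5/6 ∎
  where
  open ≤-Reasoning
  k≤2k : k ℕ.≤ 2 ℕ.* k
  k≤2k = ℕ.m≤m+n k _
  1≤2k : 1 ℕ.≤ 2 ℕ.* k
  1≤2k = ℕ.≤-trans (ℕ.≤-trans (ℕ.s≤s ℕ.z≤n) K<k) k≤2k
  D≤ : D ≤ ι (suc (suc (2 ℕ.* k)))
  D≤ = ≤-trans D≤ιK (ι-mono (ℕ.≤-trans (ℕ.n≤1+n K) (ℕ.≤-trans K<k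
    (ℕ.≤-trans k≤2k (ℕ.≤-trans (ℕ.n≤1+n _) (ℕ.n≤1+n _))))))
  below₁ : D * recip (suc (2 ℕ.* k)) ≤ 1ℚ
  below₁ = subst (D * recip (suc (2 ℕ.* k)) ≤_) (ι*recip (suc (2 ℕ.* k)))
    (*-monoʳ-≤-nonNeg (recip (suc (2 ℕ.* k))) {{nonNegative (0≤recip (suc (2 ℕ.* k)))}} D≤)

1/! : ℕ → ℚ
1/! n = (ℤ.+ 1 / n !) {{n !≢0}}

1/!-suc : ∀ n → 1/! (suc n) ≡ recip n * 1/! n
1/!-suc n = lemma (n !) {{n !≢0}} {{suc n !≢0}}
  where
  lemma : ∀ m .{{_ : ℕ.NonZero m}} .{{_ : ℕ.NonZero (suc n ℕ.* m)}} →
          ℤ.+ 1 / (suc n ℕ.* m) ≡ recip n * (ℤ.+ 1 / m)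
  lemma (suc m) = sym (/-*-/ (ℤ.+ 1) n (ℤ.+ 1) m)

mag : ℕ → ℚ → ℚ
mag k q = q ^ (2 ℕ.* k) * 1/! (2 ℕ.* k)

cosTerm-mag : ∀ k q → cosTerm k q ≡ (- 1ℚ) ^ k * mag k q
cosTerm-mag k q = *-assoc ((- 1ℚ) ^ k) (q ^ (2 ℕ.* k)) (1/! (2 ℕ.* k))

mag-suc : ∀ k q → mag (suc k) q ≡ mag k q * (q * q) * ρ k
mag-suc k q = begin
  q ^ (2 ℕ.* suc k) * 1/! (2 ℕ.* suc k)
    ≡⟨ cong (λ n → q ^ n * 1/! n) (ℕ.*-suc 2 k) ⟩
  q * (q * p) * 1/! (suc (suc n))
    ≡⟨ cong (q * (q * p) *_) (trans (1/!-suc (suc n)) (cong (recip (suc n) *_) (1/!-suc n))) ⟩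
  q * (q * p) * (recip (suc n) * (recip n * 1/! n))
    ≡⟨ solve 5 (λ q p r s f → q :* (q :* p) :* (r :* (s :* f)) := p :* f :* (q :* q) :* (r :* s))
         refl q p (recip (suc n)) (recip n) (1/! n) ⟩
  p * 1/! n * (q * q) * (recip (suc n) * recip n) ∎
  where
  open ≡-Reasoning
  n = 2 ℕ.* k
  p = q ^ n

cosTerm-suc : ∀ k q → cosTerm (suc k) q ≡ - (cosTerm k q * (q * q) * ρ k)
cosTerm-suc k q = begin
  cosTerm (suc k) q
    ≡⟨ cosTerm-mag (suc k) q ⟩
  - 1ℚ * s * mag (suc k) q
    ≡⟨ cong (- 1ℚ * s *_) (mag-suc k q) ⟩
  - 1ℚ * s * (mag k q * (q * q) * ρ k)
    ≡⟨ solve 4 (λ s m q r → con (- 1ℚ) :* s :* (m :* (q :* q) :* r) := :- (s :* m :* (q :* q) :* r))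
         refl s (mag k q) q (ρ k) ⟩
  - (s * mag k q * (q * q) * ρ k)
    ≡⟨ cong (λ t → - (t * (q * q) * ρ k)) (sym (cosTerm-mag k q)) ⟩
  - (cosTerm k q * (q * q) * ρ k) ∎
  where
  open ≡-Reasoning
  s = (- 1ℚ) ^ k

∣*∣≤ : ∀ {p q P Q} → ∣ p ∣ ≤ P → ∣ q ∣ ≤ Q → ∣ p * q ∣ ≤ P * Q
∣*∣≤ {p} {q} {P} {Q} a b = subst (_≤ P * Q) (sym (∣p*q∣≡∣p∣*∣q∣ p q))
  (*-mono-≤-0≤ (0≤∣p∣ p) (≤-trans (0≤∣p∣ q) b) a b)

∣+∣≤ : ∀ {p q P Q} → ∣ p ∣ ≤ P → ∣ q ∣ ≤ Q → ∣ p + q ∣ ≤ P + Q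
∣+∣≤ {p} {q} a b = ≤-trans (∣p+q∣≤∣p∣+∣q∣ p q) (+-mono-≤ a b)

∣ρ∣≤ : ∀ k → ∣ ρ k ∣ ≤ ρ k
∣ρ∣≤ k = ≤-reflexive (0≤p⇒∣p∣≡p (0≤ρ k))

-- On [-B , B] the k-th Taylor term of cosine is bounded by bound k, and is
-- Lipschitz with constant bound k.
module Bounded (B : ℚ) (0≤B : 0ℚ ≤ B) where

  D : ℚ
  D = B * B + (B + B)

  0≤D : 0ℚ ≤ D
  0≤D = 0≤+ (0≤* 0≤B 0≤B) (0≤+ 0≤B 0≤B)

  bound : ℕ → ℚ
  bound zero    = 1ℚ
  bound (suc k) = bound k * D * ρ k

  0≤bound : ∀ k → 0ℚ ≤ bound k
  0≤bound zero    = 0≤1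
  0≤bound (suc k) = 0≤* (0≤* (0≤bound k) 0≤D) (0≤ρ k)

  K : ℕ
  K = suc (proj₁ (≤ι D))

  bound-step : ∀ k → K ℕ.≤ k → bound (suc k) ≤ 5/6 * bound k
  bound-step k K≤k = begin
    bound k * D * ρ k   ≡⟨ solve 3 (λ b d r → b :* d :* r := (d :* r) :* b) refl (bound k) D (ρ k) ⟩
    D * ρ k * bound k   ≤⟨ *-monoʳ-≤-nonNeg (bound k) {{nonNegative (0≤bound k)}}
                             (*ρ≤5/6 0≤D (proj₂ (≤ι D)) K≤k) ⟩
    5/6 * bound k       ∎
    where open ≤-Reasoning

  open Geometric bound K 0≤bound bound-step public

  ∣cosTerm∣≤ : ∀ {q} → ∣ q ∣ ≤ B → ∀ k → ∣ cosTerm k q ∣ ≤ bound k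
  ∣cosTerm∣≤ q≤B zero = ≤-refl
  ∣cosTerm∣≤ {q} q≤B (suc k) = begin
    ∣ cosTerm (suc k) q ∣             ≡⟨ trans (cong ∣_∣ (cosTerm-suc k q)) (∣-p∣≡∣p∣ (cosTerm k q * (q * q) * ρ k)) ⟩
    ∣ cosTerm k q * (q * q) * ρ k ∣   ≤⟨ ∣*∣≤ (∣*∣≤ (∣cosTerm∣≤ q≤B k) (≤-trans (∣*∣≤ q≤B q≤B) B*B≤D)) (∣ρ∣≤ k) ⟩
    bound k * D * ρ k                 ∎
    where
    open ≤-Reasoning
    B*B≤D : B * B ≤ D
    B*B≤D = 0≤⇒≤ (0≤+ 0≤B 0≤B) (solve 1 (λ b → (b :* b :+ (b :+ b)) :- b :* b := b :+ b) refl B)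

  ∣cosTerm-∣≤ : ∀ {p q} → ∣ p ∣ ≤ B → ∣ q ∣ ≤ B →
                ∀ k → ∣ cosTerm k p - cosTerm k q ∣ ≤ bound k * ∣ p - q ∣
  ∣cosTerm-∣≤ {p} {q} _ _ zero = ≤-trans (≤-reflexive (cong ∣_∣ (+-inverseʳ 1ℚ)))
    (0≤* 0≤1 (0≤∣p∣ (p - q)))
  ∣cosTerm-∣≤ {p} {q} p≤B q≤B (suc k) = begin
    ∣ cosTerm (suc k) p - cosTerm (suc k) q ∣
      ≡⟨ cong ∣_∣ (trans (cong₂ _-_ (cosTerm-suc k p) (cosTerm-suc k q))
           (solve 5 (λ a b p q r → :- (a :* (p :* p) :* r) :- :- (b :* (q :* q) :* r)
              := :- (((a :- b) :* (p :* p) :+ b :* ((p :+ q) :* (p :- q))) :* r))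
              refl a b p q (ρ k))) ⟩
    ∣ - (((a - b) * (p * p) + b * ((p + q) * (p - q))) * ρ k) ∣
      ≡⟨ ∣-p∣≡∣p∣ (((a - b) * (p * p) + b * ((p + q) * (p - q))) * ρ k) ⟩
    ∣ ((a - b) * (p * p) + b * ((p + q) * (p - q))) * ρ k ∣
      ≤⟨ ∣*∣≤ (∣+∣≤ (∣*∣≤ (∣cosTerm-∣≤ p≤B q≤B k) (∣*∣≤ p≤B p≤B))
                    (∣*∣≤ (∣cosTerm∣≤ q≤B k) (∣*∣≤ (∣+∣≤ p≤B q≤B) (≤-refl {∣ p - q ∣})))) (∣ρ∣≤ k) ⟩
    (bound k * d * (B * B) + bound k * ((B + B) * d)) * ρ k
      ≡⟨ solve 4 (λ m d b r → (m :* d :* (b :* b) :+ m :* ((b :+ b) :* d)) :* r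
           := m :* (b :* b :+ (b :+ b)) :* r :* d) refl (bound k) d B (ρ k) ⟩
    bound k * D * ρ k * d ∎
    where
    open ≤-Reasoning
    a = cosTerm k p
    b = cosTerm k q
    d = ∣ p - q ∣

  cosSum-tail : ∀ {q} → ∣ q ∣ ≤ B → ∀ {N} → K ℕ.≤ N → ∀ n → N ℕ.≤ n →
                ∣ cosSum n q - cosSum N q ∣ ≤ 6ℚ * bound N
  cosSum-tail {q} q≤B = tail (λ n → cosSum n q) (λ n _ →
    subst (λ z → ∣ z ∣ ≤ bound n)
      (solve 2 (λ s t → t := (s :+ t) :- s) refl (cosSum n q) (cosTerm n q))
      (∣cosTerm∣≤ q≤B n))

  cosSum-lipschitz′ : ∀ {p q} → ∣ p ∣ ≤ B → ∣ q ∣ ≤ B →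
                      ∀ n → ∣ cosSum n p - cosSum n q ∣ ≤ partialSum bound n * ∣ p - q ∣
  cosSum-lipschitz′ {p} {q} _ _ zero = ≤-reflexive (sym (*-zeroˡ ∣ p - q ∣))
  cosSum-lipschitz′ {p} {q} p≤B q≤B (suc n) =
    subst (λ z → ∣ z ∣ ≤ partialSum bound (suc n) * ∣ p - q ∣)
      (solve 4 (λ a b c d → (a :- b) :+ (c :- d) := (a :+ c) :- (b :+ d)) refl
        (cosSum n p) (cosSum n q) (cosTerm n p) (cosTerm n q))
      (subst (∣ (cosSum n p - cosSum n q) + (cosTerm n p - cosTerm n q) ∣ ≤_)
        (sym (*-distribʳ-+ ∣ p - q ∣ (partialSum bound n) (bound n)))
        (∣+∣≤ (cosSum-lipschitz′ p≤B q≤B n) (∣cosTerm-∣≤ p≤B q≤B n)))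

  0≤partialSum : ∀ n → 0ℚ ≤ partialSum bound n
  0≤partialSum zero    = ≤-refl
  0≤partialSum (suc n) = 0≤+ (0≤partialSum n) (0≤bound n)

  L : ℚ
  L = partialSum bound K + 6ℚ * bound K

  0≤L : 0ℚ ≤ L
  0≤L = 0≤+ (0≤partialSum K) (0≤* (0≤ι 6) (0≤bound K))

  partialSum≤L : ∀ n → K ℕ.≤ n → partialSum bound n ≤ L
  partialSum≤L n K≤n = 0≤⇒≤ (≤⇒0≤ (≤-trans (p≤∣p∣ (s n - s K)) (tail s step ℕ.≤-refl n K≤n)))
    (solve 3 (λ a b c → (b :+ c) :- a := c :- (a :- b)) refl (s n) (s K) (6ℚ * bound K))
    where
    s = partialSum bound
    step : ∀ n → K ℕ.≤ n → ∣ s (suc n) - s n ∣ ≤ bound n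
    step n _ = ≤-reflexive (trans (cong ∣_∣ (solve 2 (λ s t → (s :+ t) :- s := t) refl (s n) (bound n)))
      (0≤p⇒∣p∣≡p (0≤bound n)))

  cosSum-lipschitz : ∀ {p q} → ∣ p ∣ ≤ B → ∣ q ∣ ≤ B → ∀ n → K ℕ.≤ n →
                     ∣ cosSum n p - cosSum n q ∣ ≤ L * ∣ p - q ∣
  cosSum-lipschitz {p} {q} p≤B q≤B n K≤n = ≤-trans (cosSum-lipschitz′ p≤B q≤B n)
    (*-monoʳ-≤-nonNeg ∣ p - q ∣ {{∣-∣-nonNeg (p - q)}} (partialSum≤L n K≤n))

eventually-bounded : ∀ u → Cauchy u → ∃[ B ] 0ℚ ≤ B × ∃[ N ] ∀ n → N ℕ.≤ n → ∣ u n ∣ ≤ B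
eventually-bounded u c with c 1ℚ (from-yes (0ℚ <? 1ℚ))
... | N , h = 1ℚ + ∣ u N ∣ , 0≤+ 0≤1 (0≤∣p∣ (u N)) , N , λ n N≤n →
  subst (λ z → ∣ z ∣ ≤ 1ℚ + ∣ u N ∣) (solve 2 (λ a b → (a :- b) :+ b := a) refl (u n) (u N))
    (∣+∣≤ (<⇒≤ (h n N N≤n ℕ.≤-refl)) ≤-refl)

cos-cauchy : ∀ u → Cauchy u → Cauchy (λ n → cosSum n (u n))
cos-cauchy u u-cauchy = pivot (λ n → cosSum n (u n)) go
  where
  b-data : ∃[ B ] 0ℚ ≤ B × ∃[ N ] ∀ n → N ℕ.≤ n → ∣ u n ∣ ≤ B
  b-data = eventually-bounded u u-cauchy
  B : ℚ
  B = proj₁ b-data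
  0≤B : 0ℚ ≤ B
  0≤B = proj₁ (proj₂ b-data)
  N₀ : ℕ
  N₀ = proj₁ (proj₂ (proj₂ b-data))
  u≤B : ∀ n → N₀ ℕ.≤ n → ∣ u n ∣ ≤ B
  u≤B = proj₂ (proj₂ (proj₂ b-data))
  open Bounded B 0≤B
  go : ∀ ε → 0ℚ < ε → ∃[ N ] ∀ n → N ℕ.≤ n → ∣ cosSum n (u n) - cosSum N (u N) ∣ < ε
  go ε 0<ε = N , close
    where
    η-data = shrink 0≤L (half-pos 0<ε)
    η = proj₁ η-data
    Lη< = proj₂ (proj₂ η-data)
    c-data = u-cauchy η (proj₁ (proj₂ η-data))
    hC = proj₂ c-data
    g-data = null (half-pos 0<ε)
    hG = proj₂ (proj₂ g-data)
    C = proj₁ c-data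
    G = proj₁ g-data
    N = C ℕ.+ (G ℕ.+ N₀)
    C≤N : C ℕ.≤ N
    C≤N = ℕ.m≤m+n C _
    G≤N : G ℕ.≤ N
    G≤N = ℕ.≤-trans (ℕ.m≤m+n G N₀) (ℕ.m≤n+m _ C)
    N₀≤N : N₀ ℕ.≤ N
    N₀≤N = ℕ.≤-trans (ℕ.m≤n+m N₀ G) (ℕ.m≤n+m _ C)
    K≤N : K ℕ.≤ N
    K≤N = ℕ.≤-trans (proj₁ (proj₂ g-data)) G≤N
    near : ∀ n → N ℕ.≤ n → ∣ cosSum n (u n) - cosSum n (u N) ∣ < half ε
    near n N≤n = begin-strict
      ∣ cosSum n (u n) - cosSum n (u N) ∣
        ≤⟨ cosSum-lipschitz (u≤B n (ℕ.≤-trans N₀≤N N≤n)) (u≤B N N₀≤N) n (ℕ.≤-trans K≤N N≤n) ⟩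
      L * ∣ u n - u N ∣
        ≤⟨ *-monoˡ-≤-nonNeg L {{nonNegative 0≤L}} (<⇒≤ (hC n N (ℕ.≤-trans C≤N N≤n) C≤N)) ⟩
      L * η
        <⟨ Lη< ⟩
      half ε ∎
      where open ≤-Reasoning
    late : ∀ n → N ℕ.≤ n → ∣ cosSum n (u N) - cosSum N (u N) ∣ < half ε
    late n N≤n = ≤-<-trans (cosSum-tail (u≤B N N₀≤N) K≤N n N≤n) (hG N G≤N)
    close : ∀ n → N ℕ.≤ n → ∣ cosSum n (u n) - cosSum N (u N) ∣ < ε
    close n N≤n = begin-strict
      ∣ cosSum n (u n) - cosSum N (u N) ∣
        ≤⟨ triangle (cosSum n (u n)) (cosSum n (u N)) (cosSum N (u N)) ⟩
      ∣ cosSum n (u n) - cosSum n (u N) ∣ + ∣ cosSum n (u N) - cosSum N (u N) ∣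
        <⟨ +-mono-< (near n N≤n) (late n N≤n) ⟩
      half ε + half ε
        ≡⟨ half+half ε ⟩
      ε ∎
      where open ≤-Reasoning

-- cos x = Σₖ (-1)ᵏ x²ᵏ / (2k)!, read off along the diagonal: the n-th
-- approximant is the sum of the first n terms at the n-th approximant of x.
cos : ℝ → ℝ
cos x = mkℝ (λ n → cosSum n (seq x n)) (cos-cauchy (seq x) (cauchy x))

cos-cong : ∀ {x y} → x ≃ᵣ y → cos x ≃ᵣ cos y
cos-cong {x} {y} x≃y ε 0<ε = N , close
  where
  x-data : ∃[ B ] 0ℚ ≤ B × ∃[ N ] ∀ n → N ℕ.≤ n → ∣ seq x n ∣ ≤ B
  x-data = eventually-bounded (seq x) (cauchy x)
  y-data : ∃[ B ] 0ℚ ≤ B × ∃[ N ] ∀ n → N ℕ.≤ n → ∣ seq y n ∣ ≤ B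
  y-data = eventually-bounded (seq y) (cauchy y)
  P Q : ℚ
  P = proj₁ x-data
  Q = proj₁ y-data
  0≤P : 0ℚ ≤ P
  0≤P = proj₁ (proj₂ x-data)
  0≤Q : 0ℚ ≤ Q
  0≤Q = proj₁ (proj₂ y-data)
  open Bounded (P + Q) (0≤+ 0≤P 0≤Q)
  η-data : ∃[ η ] 0ℚ < η × L * η < ε
  η-data = shrink 0≤L 0<ε
  η : ℚ
  η = proj₁ η-data
  c-data : ∃[ N ] ∀ n → N ℕ.≤ n → ∣ seq x n - seq y n ∣ < η
  c-data = x≃y η (proj₁ (proj₂ η-data))
  M₁ M₂ M₃ N : ℕ
  M₁ = proj₁ (proj₂ (proj₂ x-data))
  M₂ = proj₁ (proj₂ (proj₂ y-data))
  M₃ = proj₁ c-data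
  N = (M₁ ℕ.+ M₂) ℕ.+ (M₃ ℕ.+ K)
  close : ∀ n → N ℕ.≤ n → ∣ cosSum n (seq x n) - cosSum n (seq y n) ∣ < ε
  close n N≤n = begin-strict
    ∣ cosSum n (seq x n) - cosSum n (seq y n) ∣
      ≤⟨ cosSum-lipschitz
           (≤-trans (proj₂ (proj₂ (proj₂ x-data)) n (ℕ.m+n≤o⇒m≤o M₁ left))
             (0≤⇒≤ 0≤Q (solve 2 (λ p q → (p :+ q) :- p := q) refl P Q)))
           (≤-trans (proj₂ (proj₂ (proj₂ y-data)) n (ℕ.m+n≤o⇒n≤o M₁ left))
             (0≤⇒≤ 0≤P (solve 2 (λ p q → (p :+ q) :- q := p) refl P Q)))
           n (ℕ.m+n≤o⇒n≤o M₃ right) ⟩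
    L * ∣ seq x n - seq y n ∣
      ≤⟨ *-monoˡ-≤-nonNeg L {{nonNegative 0≤L}} (<⇒≤ (proj₂ c-data n (ℕ.m+n≤o⇒m≤o M₃ right))) ⟩
    L * η
      <⟨ proj₂ (proj₂ η-data) ⟩
    ε ∎
    where
    open ≤-Reasoning
    left : M₁ ℕ.+ M₂ ℕ.≤ n
    left = ℕ.m+n≤o⇒m≤o (M₁ ℕ.+ M₂) N≤n
    right : M₃ ℕ.+ K ℕ.≤ n
    right = ℕ.m+n≤o⇒n≤o (M₁ ℕ.+ M₂) N≤n

alt : (ℕ → ℚ) → ℕ → ℚ
alt U n = partialSum (λ k → (- 1ℚ) ^ k * U k) n

alt-suc : ∀ U n → alt U (suc n) ≡ U 0 - alt (λ k → U (suc k)) n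
alt-suc U zero = solve 1 (λ u → con 0ℚ :+ con 1ℚ :* u := u :- con 0ℚ) refl (U 0)
alt-suc U (suc n) = trans (cong (_+ (- 1ℚ) ^ suc n * U (suc n)) (alt-suc U n))
  (solve 4 (λ u a s v → (u :- a) :+ (con (- 1ℚ) :* s) :* v := u :- (a :+ s :* v)) refl
    (U 0) (alt (λ k → U (suc k)) n) ((- 1ℚ) ^ n) (U (suc n)))

alt-minus : ∀ U V n → alt U n - alt V n ≡ alt (λ k → U k - V k) n
alt-minus U V zero    = refl
alt-minus U V (suc n) = trans
  (solve 5 (λ a b s u v → (a :+ s :* u) :- (b :+ s :* v) := (a :- b) :+ s :* (u :- v)) refl
    (alt U n) (alt V n) ((- 1ℚ) ^ n) (U n) (V n))
  (cong (_+ (- 1ℚ) ^ n * (U n - V n)) (alt-minus U V n))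

alt-bounds : ∀ U → (∀ k → 0ℚ ≤ U k) → (∀ k → U (suc k) ≤ U k) →
             ∀ n → 0ℚ ≤ alt U n × alt U n ≤ U 0
alt-bounds U 0≤U U↓ zero    = ≤-refl , 0≤U 0
alt-bounds U 0≤U U↓ (suc n) =
  subst (0ℚ ≤_) (sym (alt-suc U n)) (≤⇒0≤ (≤-trans (proj₂ ih) (U↓ 0))) ,
  0≤⇒≤ (proj₁ ih) (trans (cong (λ z → U 0 - z) (alt-suc U n))
    (solve 2 (λ u a → u :- (u :- a) := a) refl (U 0) A))
  where
  A : ℚ
  A = alt (λ k → U (suc k)) n
  ih : 0ℚ ≤ A × A ≤ U 1
  ih = alt-bounds (λ k → U (suc k)) (λ k → 0≤U (suc k)) (λ k → U↓ (suc k)) n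

alt-lower : ∀ U → (∀ k → 0ℚ ≤ U k) → (∀ k → U (suc k) ≤ U k) →
            ∀ n → U 0 - U 1 ≤ alt U (suc n)
alt-lower U 0≤U U↓ n = subst (U 0 - U 1 ≤_) (sym (alt-suc U n))
  (+-monoʳ-≤ (U 0) (neg-antimono-≤
    (proj₂ (alt-bounds (λ k → U (suc k)) (λ k → 0≤U (suc k)) (λ k → U↓ (suc k)) n))))

cosSum-alt : ∀ n q → cosSum n q ≡ alt (λ k → mag k q) n
cosSum-alt zero    q = refl
cosSum-alt (suc n) q = cong₂ _+_ (cosSum-alt n q) (cosTerm-mag n q)

cosSum-suc : ∀ n q → cosSum (suc n) q ≡ 1ℚ - alt (λ k → mag (suc k) q) n
cosSum-suc n q = trans (cosSum-alt (suc n) q) (alt-suc (λ k → mag k q) n)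

mag-1 : ∀ q → mag 1 q ≡ ½ * (q * q)
mag-1 q = trans (mag-suc 0 q)
  (solve 1 (λ q → con 1ℚ :* (q :* q) :* con ½ := con ½ :* (q :* q)) refl q)

0≤mag : ∀ {q} → 0ℚ ≤ q → ∀ k → 0ℚ ≤ mag k q
0≤mag 0≤q zero = 0≤1
0≤mag {q} 0≤q (suc k) = subst (0ℚ ≤_) (sym (mag-suc k q))
  (0≤* (0≤* (0≤mag 0≤q k) (0≤* 0≤q 0≤q)) (0≤ρ k))

1/12 2/3 1/3 1/6 2ℚ 4ℚ : ℚ
1/12 = ℤ.+ 1 / 12
2/3  = ℤ.+ 2 / 3
1/3  = ℤ.+ 1 / 3
1/6  = ℤ.+ 1 / 6
2ℚ   = ι 2
4ℚ   = ι 4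

0≤2 : 0ℚ ≤ 2ℚ
0≤2 = 0≤ι 2

ρ≤1/12 : ∀ k → ρ (suc k) ≤ 1/12
ρ≤1/12 k = ρ-anti {1} {suc k} (ℕ.s≤s ℕ.z≤n)

module Pair {x y : ℚ} (0≤x : 0ℚ ≤ x) (x≤y : x ≤ y) (y≤2 : y ≤ 2ℚ) where

  a b : ℚ
  a = x * x
  b = y * y

  T : ℕ → ℚ
  T k = mag (suc k) y - mag (suc k) x

  0≤y : 0ℚ ≤ y
  0≤y = ≤-trans 0≤x x≤y

  0≤a : 0ℚ ≤ a
  0≤a = 0≤* 0≤x 0≤x

  0≤b : 0ℚ ≤ b
  0≤b = 0≤* 0≤y 0≤y

  a≤b : 0ℚ ≤ b - a
  a≤b = ≤⇒0≤ (*-mono-≤-0≤ 0≤x 0≤y x≤y x≤y)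

  b≤4 : 0ℚ ≤ 4ℚ - b
  b≤4 = ≤⇒0≤ (*-mono-≤-0≤ 0≤y 0≤2 y≤2 y≤2)

  T-0 : T 0 ≡ ½ * (b - a)
  T-0 = trans (cong₂ _-_ (mag-1 y) (mag-1 x))
    (solve 2 (λ a b → con ½ :* b :- con ½ :* a := con ½ :* (b :- a)) refl a b)

  T-suc : ∀ k → T (suc k) ≡ ρ (suc k) * (b * T k + (b - a) * mag (suc k) x)
  T-suc k = trans (cong₂ _-_ (mag-suc (suc k) y) (mag-suc (suc k) x))
    (solve 5 (λ m n a b r → n :* b :* r :- m :* a :* r := r :* (b :* (n :- m) :+ (b :- a) :* m))
      refl (mag (suc k) x) (mag (suc k) y) a b (ρ (suc k)))

  invariant : ∀ k → 0ℚ ≤ T k × 0ℚ ≤ b * T k - (b - a) * mag (suc k) x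
  invariant zero =
    subst (0ℚ ≤_) (sym T-0) (0≤* 0≤½ a≤b) ,
    subst (0ℚ ≤_) (sym (trans (cong₂ (λ t m → b * t - (b - a) * m) T-0 (mag-1 x))
      (solve 2 (λ a b → b :* (con ½ :* (b :- a)) :- (b :- a) :* (con ½ :* a)
        := con ½ :* ((b :- a) :* (b :- a))) refl a b)))
      (0≤* 0≤½ (0≤* a≤b a≤b))
    where
    0≤½ : 0ℚ ≤ ½
    0≤½ = from-yes (0ℚ ≤? ½)
  invariant (suc k) =
    subst (0ℚ ≤_) (sym (T-suc k)) (0≤* (0≤ρ (suc k)) (0≤+ (0≤* 0≤b 0≤T) (0≤* a≤b 0≤m))) ,
    subst (0ℚ ≤_) (sym (trans (cong₂ (λ t m → b * t - (b - a) * m) (T-suc k) (mag-suc (suc k) x))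
      (solve 5 (λ a b t m r →
        b :* (r :* (b :* t :+ (b :- a) :* m)) :- (b :- a) :* (m :* a :* r)
          := r :* (a :* (b :* t :- (b :- a) :* m) :+ (b :- a) :* (b :* t) :+ b :* ((b :- a) :* m)))
        refl a b (T k) (mag (suc k) x) (ρ (suc k)))))
      (0≤* (0≤ρ (suc k)) (0≤+ (0≤+ (0≤* 0≤a (proj₂ (invariant k)))
        (0≤* a≤b (0≤* 0≤b 0≤T))) (0≤* 0≤b (0≤* a≤b 0≤m))))
    where
    0≤T : 0ℚ ≤ T k
    0≤T = proj₁ (invariant k)
    0≤m : 0ℚ ≤ mag (suc k) x
    0≤m = 0≤mag 0≤x (suc k)

  0≤T : ∀ k → 0ℚ ≤ T k
  0≤T k = proj₁ (invariant k)

  T-ratio : ∀ k → T (suc k) ≤ 2/3 * T k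
  T-ratio k = 0≤⇒≤
    (0≤+ (0≤* (0≤+ (0≤* (0≤* 0≤2 (0≤ρ (suc k))) b≤4) (0≤* (0≤ι 8) (≤⇒0≤ (ρ≤1/12 k)))) (0≤T k))
         (0≤* (0≤ρ (suc k)) (proj₂ (invariant k))))
    (trans (cong (λ z → 2/3 * T k - z) (T-suc k))
      (solve 5 (λ a b t m r → con 2/3 :* t :- r :* (b :* t :+ (b :- a) :* m)
        := (con 2ℚ :* r :* (con 4ℚ :- b) :+ con (ι 8) :* (con 1/12 :- r)) :* t
           :+ r :* (b :* t :- (b :- a) :* m)) refl a b (T k) (mag (suc k) x) (ρ (suc k))))

  T↓ : ∀ k → T (suc k) ≤ T k
  T↓ k = ≤-trans (T-ratio k) (0≤⇒≤ (0≤* (from-yes (0ℚ ≤? 1/3)) (0≤T k))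
    (solve 1 (λ t → t :- con 2/3 :* t := con 1/3 :* t) refl (T k)))

  cosSum-diff : ∀ n → cosSum (suc (suc n)) x - cosSum (suc (suc n)) y ≡ alt T (suc n)
  cosSum-diff n = trans (cong₂ _-_ (cosSum-suc (suc n) x) (cosSum-suc (suc n) y))
    (trans (solve 2 (λ u v → (con 1ℚ :- u) :- (con 1ℚ :- v) := v :- u) refl
             (alt (λ k → mag (suc k) x) (suc n)) (alt (λ k → mag (suc k) y) (suc n)))
           (alt-minus (λ k → mag (suc k) y) (λ k → mag (suc k) x) (suc n)))

  cosSum-upper : ∀ n → cosSum (suc (suc n)) x - cosSum (suc (suc n)) y ≤ ½ * (b - a)
  cosSum-upper n = begin
    cosSum (suc (suc n)) x - cosSum (suc (suc n)) y   ≡⟨ cosSum-diff n ⟩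
    alt T (suc n)                                     ≤⟨ proj₂ (alt-bounds T 0≤T T↓ (suc n)) ⟩
    T 0                                               ≡⟨ T-0 ⟩
    ½ * (b - a)                                       ∎
    where open ≤-Reasoning

  cosSum-lower : ∀ n → 1/6 * (b - a) ≤ cosSum (suc (suc n)) x - cosSum (suc (suc n)) y
  cosSum-lower n = begin
    1/6 * (b - a)         ≡⟨ solve 1 (λ c → con 1/6 :* c := con 1/3 :* (con ½ :* c)) refl (b - a) ⟩
    1/3 * (½ * (b - a))   ≡⟨ cong (1/3 *_) (sym T-0) ⟩
    1/3 * T 0             ≤⟨ 0≤⇒≤ (≤⇒0≤ (T-ratio 0))
                               (solve 2 (λ t u → (t :- u) :- con 1/3 :* t := con 2/3 :* t :- u) refl (T 0) (T 1)) ⟩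
    T 0 - T 1             ≤⟨ alt-lower T 0≤T T↓ n ⟩
    alt T (suc n)         ≡⟨ sym (cosSum-diff n) ⟩
    cosSum (suc (suc n)) x - cosSum (suc (suc n)) y ∎
    where open ≤-Reasoning

mag₂-ratio : ∀ k → mag (suc (suc k)) 2ℚ ≤ 1/3 * mag (suc k) 2ℚ
mag₂-ratio k = 0≤⇒≤ (0≤* (0≤* (0≤ι 4) (≤⇒0≤ (ρ≤1/12 k))) (0≤mag 0≤2 (suc k)))
  (trans (cong (λ z → 1/3 * mag (suc k) 2ℚ - z) (mag-suc (suc k) 2ℚ))
    (solve 2 (λ m r → con 1/3 :* m :- m :* (con 2ℚ :* con 2ℚ) :* r
      := con 4ℚ :* (con 1/12 :- r) :* m) refl (mag (suc k) 2ℚ) (ρ (suc k))))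

0≤cosSum-1 : ∀ n → 0ℚ ≤ cosSum n 1ℚ
0≤cosSum-1 n = subst (0ℚ ≤_) (sym (cosSum-alt n 1ℚ))
  (proj₁ (alt-bounds (λ k → mag k 1ℚ) (0≤mag 0≤1) mag↓ n))
  where
  mag↓ : ∀ k → mag (suc k) 1ℚ ≤ mag k 1ℚ
  mag↓ k = 0≤⇒≤ (0≤* (≤⇒0≤ ρ≤1) (0≤mag 0≤1 k))
    (trans (cong (λ z → mag k 1ℚ - z) (mag-suc k 1ℚ))
      (solve 2 (λ m r → m :- m :* (con 1ℚ :* con 1ℚ) :* r := (con 1ℚ :- r) :* m) refl (mag k 1ℚ) (ρ k)))
    where
    ρ≤1 : ρ k ≤ 1ℚ
    ρ≤1 = ≤-trans (ρ-anti {0} {k} ℕ.z≤n) (from-yes (½ ≤? 1ℚ))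

cosSum-2≤0 : ∀ n → cosSum (suc (suc n)) 2ℚ ≤ 0ℚ
cosSum-2≤0 n = 0≤⇒≤ (0≤+ (0≤+ (≤⇒0≤ (alt-lower V 0≤V V↓ n)) (≤⇒0≤ (mag₂-ratio 0))) 0≤1/3)
  (trans (cong (λ z → 0ℚ - z) (cosSum-suc (suc n) 2ℚ))
    (subst (λ v → ∀ w z → 0ℚ - (1ℚ - z) ≡ (z - (v - w)) + (1/3 * v - w) + 1/3) (sym (mag-1 2ℚ))
      (λ w z → solve 2 (λ w z → con 0ℚ :- (con 1ℚ :- z)
         := (z :- (con 2ℚ :- w)) :+ (con 1/3 :* con 2ℚ :- w) :+ con 1/3 ) refl w z)
      (V 1) (alt V (suc n))))
  where
  0≤1/3 : 0ℚ ≤ 1/3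
  0≤1/3 = from-yes (0ℚ ≤? 1/3)
  V : ℕ → ℚ
  V k = mag (suc k) 2ℚ
  0≤V : ∀ k → 0ℚ ≤ V k
  0≤V k = 0≤mag 0≤2 (suc k)
  V↓ : ∀ k → V (suc k) ≤ V k
  V↓ k = ≤-trans (mag₂-ratio k) (0≤⇒≤ (0≤* (from-yes (0ℚ ≤? 2/3)) (0≤V k))
    (solve 1 (λ t → t :- con 1/3 :* t := con 2/3 :* t) refl (V k)))

-- The iteration x ↦ x + (cos x) / 2, with the n-th partial sum of cosine at
-- step n.  It contracts [1 , 2] with ratio 5/6.
halfπ-seq : ℕ → ℚ
halfπ-seq zero    = 1ℚ
halfπ-seq (suc n) = halfπ-seq n + ½ * cosSum n (halfπ-seq n)

relax : ℕ → ℚ → ℚ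
relax n x = x + ½ * cosSum n x

module _ {x y : ℚ} (1≤x : 1ℚ ≤ x) (x≤y : x ≤ y) (y≤2 : y ≤ 2ℚ) (n : ℕ) where
  private
    N = suc (suc n)
    open Pair (≤-trans 0≤1 1≤x) x≤y y≤2
    p = cosSum N x
    q = cosSum N y
    0≤y-x : 0ℚ ≤ y - x
    0≤y-x = ≤⇒0≤ x≤y
    1≤y : 1ℚ ≤ y
    1≤y = ≤-trans 1≤x x≤y

  relax-mono : 0ℚ ≤ relax N y - relax N x
  relax-mono = subst (0ℚ ≤_)
    (solve 4 (λ x y p q →
      con ½ :* (con ½ :* (y :* y :- x :* x) :- (p :- q))
        :+ con ¼ :* ((y :- x) :* ((con 2ℚ :- y) :+ (con 2ℚ :- x)))
      := (y :+ con ½ :* q) :- (x :+ con ½ :* p)) refl x y p q)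
    (0≤+ (0≤* (from-yes (0ℚ ≤? ½)) (≤⇒0≤ (cosSum-upper n)))
         (0≤* (from-yes (0ℚ ≤? ¼)) (0≤* 0≤y-x (0≤+ (≤⇒0≤ y≤2) (≤⇒0≤ (≤-trans x≤y y≤2))))))
    where
    ¼ : ℚ
    ¼ = ℤ.+ 1 / 4

  relax-contracts : relax N y - relax N x ≤ 5/6 * (y - x)
  relax-contracts = 0≤⇒≤
    (0≤+ (0≤* (from-yes (0ℚ ≤? ½)) (≤⇒0≤ (cosSum-lower n)))
         (0≤* (from-yes (0ℚ ≤? 1/12)) (0≤* 0≤y-x (0≤+ (≤⇒0≤ 1≤x) (≤⇒0≤ 1≤y)))))
    (solve 4 (λ x y p q →
      con 5/6 :* (y :- x) :- ((y :+ con ½ :* q) :- (x :+ con ½ :* p))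
      := con ½ :* ((p :- q) :- con 1/6 :* (y :* y :- x :* x))
        :+ con 1/12 :* ((y :- x) :* ((x :- con 1ℚ) :+ (y :- con 1ℚ)))) refl x y p q)

InRange : ℚ → Set
InRange x = 1ℚ ≤ x × x ≤ 2ℚ

relax-range : ∀ n {x} → InRange x → InRange (relax (suc (suc n)) x)
relax-range n {x} (1≤x , x≤2) =
  0≤⇒≤ (0≤+ (relax-mono ≤-refl 1≤x x≤2 n) (0≤* (from-yes (0ℚ ≤? ½)) (0≤cosSum-1 (suc (suc n)))))
    (solve 2 (λ r c → r :- con 1ℚ := (r :- (con 1ℚ :+ con ½ :* c)) :+ con ½ :* c) refl
      (relax (suc (suc n)) x) (cosSum (suc (suc n)) 1ℚ)) ,
  0≤⇒≤ (0≤+ (relax-mono 1≤x x≤2 ≤-refl n) (0≤* (from-yes (0ℚ ≤? ½)) (≤⇒0≤ (cosSum-2≤0 n))))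
    (solve 2 (λ r c → con 2ℚ :- r := ((con 2ℚ :+ con ½ :* c) :- r) :+ con ½ :* (con 0ℚ :- c)) refl
      (relax (suc (suc n)) x) (cosSum (suc (suc n)) 2ℚ))

relax-lipschitz : ∀ n {x y} → InRange x → InRange y →
                  ∣ relax (suc (suc n)) y - relax (suc (suc n)) x ∣ ≤ 5/6 * ∣ y - x ∣
relax-lipschitz n {x} {y} (1≤x , x≤2) (1≤y , y≤2) = [ below , above ]′ (≤-total x y)
  where
  N = suc (suc n)
  ordered : ∀ {x y} → 1ℚ ≤ x → x ≤ y → y ≤ 2ℚ →
            ∣ relax N y - relax N x ∣ ≤ 5/6 * ∣ y - x ∣
  ordered {x} {y} 1≤x x≤y y≤2 = begin
    ∣ relax N y - relax N x ∣   ≡⟨ 0≤p⇒∣p∣≡p (relax-mono 1≤x x≤y y≤2 n) ⟩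
    relax N y - relax N x       ≤⟨ relax-contracts 1≤x x≤y y≤2 n ⟩
    5/6 * (y - x)               ≡⟨ cong (5/6 *_) (sym (0≤p⇒∣p∣≡p (≤⇒0≤ x≤y))) ⟩
    5/6 * ∣ y - x ∣             ∎
    where open ≤-Reasoning
  below : x ≤ y → ∣ relax N y - relax N x ∣ ≤ 5/6 * ∣ y - x ∣
  below x≤y = ordered 1≤x x≤y y≤2
  above : y ≤ x → ∣ relax N y - relax N x ∣ ≤ 5/6 * ∣ y - x ∣
  above y≤x = begin
    ∣ relax N y - relax N x ∣   ≡⟨ ∣-∣-sym (relax N y) (relax N x) ⟩
    ∣ relax N x - relax N y ∣   ≤⟨ ordered 1≤y y≤x x≤2 ⟩
    5/6 * ∣ x - y ∣             ≡⟨ cong (5/6 *_) (∣-∣-sym x y) ⟩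
    5/6 * ∣ y - x ∣             ∎
    where open ≤-Reasoning

halfπ-range : ∀ n → InRange (halfπ-seq n)
halfπ-range 0 = ≤-refl , from-yes (1ℚ ≤? 2ℚ)
halfπ-range 1 = from-yes (1ℚ ≤? halfπ-seq 1) , from-yes (halfπ-seq 1 ≤? 2ℚ)
halfπ-range 2 = from-yes (1ℚ ≤? halfπ-seq 2) , from-yes (halfπ-seq 2 ≤? 2ℚ)
halfπ-range (suc (suc (suc n))) = relax-range n (halfπ-range (suc (suc n)))

∣-1^∣ : ∀ k → ∣ (- 1ℚ) ^ k ∣ ≡ 1ℚ
∣-1^∣ zero    = refl
∣-1^∣ (suc k) = trans (∣p*q∣≡∣p∣*∣q∣ (- 1ℚ) ((- 1ℚ) ^ k))
  (trans (*-identityˡ ∣ (- 1ℚ) ^ k ∣) (∣-1^∣ k))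

halfπ-error : ℕ → ℚ
halfπ-error n = ∣ halfπ-seq (suc n) - halfπ-seq n ∣ + mag n 2ℚ

0≤halfπ-error : ∀ n → 0ℚ ≤ halfπ-error n
0≤halfπ-error n = 0≤+ (0≤∣p∣ (halfπ-seq (suc n) - halfπ-seq n)) (0≤mag 0≤2 n)

halfπ-error-step : ∀ n → 2 ℕ.≤ n → halfπ-error (suc n) ≤ 5/6 * halfπ-error n
halfπ-error-step (suc zero) (ℕ.s≤s ())
halfπ-error-step (suc (suc m)) _ = begin
  ∣ h (suc (suc n)) - h (suc n) ∣ + mag (suc n) 2ℚ
    ≤⟨ +-mono-≤ difference (mag₂-ratio (suc m)) ⟩
  (½ * w + 5/6 * d) + 1/3 * w
    ≡⟨ solve 2 (λ w d → (con ½ :* w :+ con 5/6 :* d) :+ con 1/3 :* w := con 5/6 :* (d :+ w)) refl w d ⟩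
  5/6 * (d + w) ∎
  where
  open ≤-Reasoning
  n = suc (suc m)
  h = halfπ-seq
  w = mag n 2ℚ
  d = ∣ h (suc n) - h n ∣
  1≤h = proj₁ (halfπ-range (suc n))
  term≤w : ∣ cosTerm n (h (suc n)) ∣ ≤ w
  term≤w = begin
    ∣ cosTerm n (h (suc n)) ∣
      ≡⟨ cong ∣_∣ (cosTerm-mag n (h (suc n))) ⟩
    ∣ (- 1ℚ) ^ n * mag n (h (suc n)) ∣
      ≡⟨ ∣p*q∣≡∣p∣*∣q∣ ((- 1ℚ) ^ n) (mag n (h (suc n))) ⟩
    ∣ (- 1ℚ) ^ n ∣ * ∣ mag n (h (suc n)) ∣
      ≡⟨ cong₂ _*_ (∣-1^∣ n) (0≤p⇒∣p∣≡p (0≤mag (≤-trans 0≤1 1≤h) n)) ⟩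
    1ℚ * mag n (h (suc n))
      ≡⟨ *-identityˡ (mag n (h (suc n))) ⟩
    mag n (h (suc n))
      ≤⟨ 0≤⇒≤ (Pair.0≤T (≤-trans 0≤1 1≤h) (proj₂ (halfπ-range (suc n))) ≤-refl (suc m)) refl ⟩
    w ∎
  difference : ∣ h (suc (suc n)) - h (suc n) ∣ ≤ ½ * w + 5/6 * d
  difference = begin
    ∣ h (suc (suc n)) - h (suc n) ∣
      ≡⟨ cong ∣_∣ (solve 4 (λ x c t z → (x :+ con ½ :* (c :+ t)) :- z
           := con ½ :* t :+ ((x :+ con ½ :* c) :- z)) refl
           (h (suc n)) (cosSum n (h (suc n))) (cosTerm n (h (suc n))) (h (suc n))) ⟩
    ∣ ½ * cosTerm n (h (suc n)) + (relax n (h (suc n)) - relax n (h n)) ∣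
      ≤⟨ ∣+∣≤ (∣*∣≤ (≤-refl {½}) term≤w)
              (relax-lipschitz m (halfπ-range n) (halfπ-range (suc n))) ⟩
    ½ * w + 5/6 * d ∎

module HalfπConvergence = Geometric halfπ-error 2 0≤halfπ-error halfπ-error-step

halfπ-cauchy : Cauchy halfπ-seq
halfπ-cauchy = pivot halfπ-seq go
  where
  open HalfπConvergence
  step : ∀ n → 2 ℕ.≤ n → ∣ halfπ-seq (suc n) - halfπ-seq n ∣ ≤ halfπ-error n
  step n _ = 0≤⇒≤ (0≤mag 0≤2 n)
    (solve 2 (λ d w → (d :+ w) :- d := w) refl ∣ halfπ-seq (suc n) - halfπ-seq n ∣ (mag n 2ℚ))
  go : ∀ ε → 0ℚ < ε → ∃[ N ] ∀ n → N ℕ.≤ n → ∣ halfπ-seq n - halfπ-seq N ∣ < ε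
  go ε 0<ε = N , λ n N≤n → ≤-<-trans (tail halfπ-seq step (proj₁ (proj₂ data′)) n N≤n)
                                     (proj₂ (proj₂ data′) N ℕ.≤-refl)
    where
    data′ : ∃[ N ] 2 ℕ.≤ N × (∀ n → N ℕ.≤ n → 6ℚ * halfπ-error n < ε)
    data′ = null 0<ε
    N : ℕ
    N = proj₁ data′

halfπ : ℝ
halfπ = mkℝ halfπ-seq halfπ-cauchy

infixl 6 _+ᵣ_

_+ᵣ_ : ℝ → ℝ → ℝ
x +ᵣ y = mkℝ (λ n → seq x n + seq y n) go
  where
  go : Cauchy (λ n → seq x n + seq y n)
  go ε 0<ε = N ℕ.+ M , close
    where
    x-data = cauchy x (half ε) (half-pos 0<ε)
    y-data = cauchy y (half ε) (half-pos 0<ε)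
    N = proj₁ x-data
    M = proj₁ y-data
    close : ∀ m n → N ℕ.+ M ℕ.≤ m → N ℕ.+ M ℕ.≤ n →
            ∣ (seq x m + seq y m) - (seq x n + seq y n) ∣ < ε
    close m n ≤m ≤n = begin-strict
      ∣ (seq x m + seq y m) - (seq x n + seq y n) ∣
        ≡⟨ cong ∣_∣ (solve 4 (λ a b c d → (a :+ b) :- (c :+ d) := (a :- c) :+ (b :- d)) refl
             (seq x m) (seq y m) (seq x n) (seq y n)) ⟩
      ∣ (seq x m - seq x n) + (seq y m - seq y n) ∣
        ≤⟨ ∣p+q∣≤∣p∣+∣q∣ (seq x m - seq x n) (seq y m - seq y n) ⟩
      ∣ seq x m - seq x n ∣ + ∣ seq y m - seq y n ∣
        <⟨ +-mono-< (proj₂ x-data m n (ℕ.m+n≤o⇒m≤o N ≤m) (ℕ.m+n≤o⇒m≤o N ≤n))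
                    (proj₂ y-data m n (ℕ.m+n≤o⇒n≤o N ≤m) (ℕ.m+n≤o⇒n≤o N ≤n)) ⟩
      half ε + half ε
        ≡⟨ half+half ε ⟩
      ε ∎
      where open ≤-Reasoning

fromℚ : ℚ → ℝ
fromℚ q = mkℝ (λ _ → q) λ ε 0<ε → 0 , λ _ _ _ _ → subst (_< ε) (sym (cong ∣_∣ (+-inverseʳ q))) 0<ε

IsLeastPositiveZero : (ℝ → ℝ) → ℝ → Set
IsLeastPositiveZero f x =
  fromℚ 0ℚ <ᵣ x × f x ≃ᵣ fromℚ 0ℚ × (∀ y → fromℚ 0ℚ <ᵣ y → y <ᵣ x → ¬ (f y ≃ᵣ fromℚ 0ℚ))

cos-halfπ : cos halfπ ≃ᵣ fromℚ 0ℚ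
cos-halfπ ε 0<ε = N , close
  where
  data′ : ∃[ N ] ∀ m n → N ℕ.≤ m → N ℕ.≤ n → ∣ halfπ-seq m - halfπ-seq n ∣ < half ε
  data′ = halfπ-cauchy (half ε) (half-pos 0<ε)
  N : ℕ
  N = proj₁ data′
  close : ∀ n → N ℕ.≤ n → ∣ cosSum n (halfπ-seq n) - 0ℚ ∣ < ε
  close n N≤n = begin-strict
    ∣ c - 0ℚ ∣
      ≡⟨ cong ∣_∣ (solve 2 (λ c h → c :- con 0ℚ
           := ((h :+ con ½ :* c) :- h) :+ ((h :+ con ½ :* c) :- h)) refl c (halfπ-seq n)) ⟩
    ∣ d + d ∣
      ≤⟨ ∣p+q∣≤∣p∣+∣q∣ d d ⟩
    ∣ d ∣ + ∣ d ∣
      <⟨ +-mono-< d<half d<half ⟩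
    half ε + half ε
      ≡⟨ half+half ε ⟩
    ε ∎
    where
    open ≤-Reasoning
    c = cosSum n (halfπ-seq n)
    d = halfπ-seq (suc n) - halfπ-seq n
    d<half : ∣ d ∣ < half ε
    d<half = proj₂ data′ (suc n) n (ℕ.≤-trans N≤n (ℕ.n≤1+n n)) N≤n

no-smaller-zero : ∀ y → fromℚ 0ℚ <ᵣ y → y <ᵣ halfπ → ¬ (cos y ≃ᵣ fromℚ 0ℚ)
no-smaller-zero y (ε₁ , 0<ε₁ , N₁ , h₁) (ε₂ , 0<ε₂ , N₂ , h₂) cosy≃0 =
  <-irrefl refl (<-≤-trans small big)
  where
  κ : ℚ
  κ = 1/6 * ε₂
  0<κ : 0ℚ < κ
  0<κ = 0<* (from-yes (0ℚ <? 1/6)) 0<ε₂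
  y-data = cosy≃0 (half κ) (half-pos 0<κ)
  h-data = cos-halfπ (half κ) (half-pos 0<κ)
  M₁ M₂ n N : ℕ
  M₁ = proj₁ y-data
  M₂ = proj₁ h-data
  n = (N₁ ℕ.+ N₂) ℕ.+ (M₁ ℕ.+ M₂)
  N = suc (suc n)
  n≤N : n ℕ.≤ N
  n≤N = ℕ.m≤n+m n 2
  N₁≤N : N₁ ℕ.≤ N
  N₁≤N = ℕ.≤-trans (ℕ.m≤m+n N₁ N₂) (ℕ.≤-trans (ℕ.m≤m+n (N₁ ℕ.+ N₂) _) n≤N)
  N₂≤N : N₂ ℕ.≤ N
  N₂≤N = ℕ.≤-trans (ℕ.m≤n+m N₂ N₁) (ℕ.≤-trans (ℕ.m≤m+n (N₁ ℕ.+ N₂) _) n≤N)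
  M₁≤N : M₁ ℕ.≤ N
  M₁≤N = ℕ.≤-trans (ℕ.m≤m+n M₁ M₂) (ℕ.≤-trans (ℕ.m≤n+m (M₁ ℕ.+ M₂) (N₁ ℕ.+ N₂)) n≤N)
  M₂≤N : M₂ ℕ.≤ N
  M₂≤N = ℕ.≤-trans (ℕ.m≤n+m M₂ M₁) (ℕ.≤-trans (ℕ.m≤n+m (M₁ ℕ.+ M₂) (N₁ ℕ.+ N₂)) n≤N)
  u v p q : ℚ
  u = seq y N
  v = halfπ-seq N
  p = cosSum N u
  q = cosSum N v
  0≤u : 0ℚ ≤ u
  0≤u = <⇒≤ (<-trans (p<p+q 0ℚ 0<ε₁) (h₁ N N₁≤N))
  ε₂≤v-u : 0ℚ ≤ v - (u + ε₂)
  ε₂≤v-u = ≤⇒0≤ (<⇒≤ (h₂ N N₂≤N))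
  u≤v : u ≤ v
  u≤v = <⇒≤ (<-trans (p<p+q u 0<ε₂) (h₂ N N₂≤N))
  1≤v : 1ℚ ≤ v
  1≤v = proj₁ (halfπ-range N)
  0≤v : 0ℚ ≤ v
  0≤v = ≤-trans 0≤1 1≤v
  big : κ ≤ p - q
  big = ≤-trans
    (0≤⇒≤ (0≤* (from-yes (0ℚ ≤? 1/6))
             (0≤+ (0≤* ε₂≤v-u (0≤+ 0≤v 0≤u)) (0≤* (<⇒≤ 0<ε₂) (0≤+ (≤⇒0≤ 1≤v) 0≤u))))
      (solve 3 (λ u v e → con 1/6 :* (v :* v :- u :* u) :- con 1/6 :* e
        := con 1/6 :* ((v :- (u :+ e)) :* (v :+ u) :+ e :* ((v :- con 1ℚ) :+ u))) refl u v ε₂))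
    (Pair.cosSum-lower 0≤u u≤v (proj₂ (halfπ-range N)) n)
  small : p - q < κ
  small = begin-strict
    p - q
      ≤⟨ p≤∣p∣ (p - q) ⟩
    ∣ p - q ∣
      ≤⟨ triangle p 0ℚ q ⟩
    ∣ p - 0ℚ ∣ + ∣ 0ℚ - q ∣
      ≡⟨ cong (∣ p - 0ℚ ∣ +_) (∣-∣-sym 0ℚ q) ⟩
    ∣ p - 0ℚ ∣ + ∣ q - 0ℚ ∣
      <⟨ +-mono-< (proj₂ y-data N M₁≤N) (proj₂ h-data N M₂≤N) ⟩
    half κ + half κ
      ≡⟨ half+half κ ⟩
    κ ∎
    where open ≤-Reasoning

0<halfπ : fromℚ 0ℚ <ᵣ halfπ
0<halfπ = ½ , from-yes (0ℚ <? ½) , 0 , λ n _ →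
  <-≤-trans (from-yes (0ℚ + ½ <? 1ℚ)) (proj₁ (halfπ-range n))

halfπ-isLeastPositiveZero : IsLeastPositiveZero cos halfπ
halfπ-isLeastPositiveZero = 0<halfπ , cos-halfπ , no-smaller-zero

-- That halfπ = π/2 is what halfπ-isLeastPositiveZero shows; the iteration
-- defining it is only a construction of that number.
π : ℝ
π = halfπ +ᵣ halfπ

Irrational : ℝ → Set
Irrational x = ¬ (∃[ q ] x ≃ᵣ fromℚ q)

{-# OPTIONS --safe #-}

-- After Laczkovich.  Put t = h² = a / b and
--   Gₘ = aᵐ Σⱼ (-t)ʲ / ((2j)!! (2j + 2m - 1)!!),
-- so that G₀ = cos h.  Then Gₘ₊₂ = b (2m + 1) Gₘ₊₁ - a b Gₘ, and hence, if
-- cos h = 0, every Gₘ is an integer multiple of G₁.  But for 1 ≤ h ≤ 2 all Gₘ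
-- with m ≥ 1 are positive, G₁ ≥ 1/3, and Gₘ → 0.
module Submission where

open import Defs

open import Data.Nat.Base as ℕ using (ℕ; zero; suc)
import Data.Nat.Properties as ℕ
import Data.Nat.Solver as ℕ
open import Data.Integer.Base as ℤ using (ℤ)
import Data.Integer.Properties as ℤ
open import Data.Rational.Base
open import Data.Rational.Properties
import Data.Rational.Unnormalised.Base as ℚᵘ
import Data.Rational.Unnormalised.Properties as ℚᵘ
open import Data.Rational.Solver using (module +-*-Solver)
open import Algebra.Definitions.RawSemiring +-*-rawSemiring using (_^_)
open import Data.Product.Base using (_×_; _,_; ∃-syntax; proj₁; proj₂)
open import Function.Base using (_∘_)
open import Relation.Nullary.Negation.Core using (¬_)
open import Relation.Nullary.Decidable.Core using (from-yes)
open import Relation.Binary.PropositionalEquality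
  using (_≡_; refl; sym; trans; cong; cong₂; subst; module ≡-Reasoning)

open +-*-Solver using (solve; _:=_; _:+_; _:*_; :-_; _:-_; con)

-- Integers and fractions inside the rationals

fromℤ : ℤ → ℚ
fromℤ i = i / 1

fromℤ-+ : ∀ i j → fromℤ (i ℤ.+ j) ≡ fromℤ i + fromℤ j
fromℤ-+ i j = toℚᵘ-injective
  (ℚᵘ.≃-trans (toℚᵘ-/ (i ℤ.+ j) 0)
  (ℚᵘ.≃-trans (ℚᵘ.*≡* (cong (ℤ._* ℤ.+ 1)
    (sym (cong₂ ℤ._+_ (ℤ.*-identityʳ i) (ℤ.*-identityʳ j)))))
  (ℚᵘ.≃-sym (ℚᵘ.≃-trans (toℚᵘ-homo-+ (fromℤ i) (fromℤ j))
    (ℚᵘ.+-cong (toℚᵘ-/ i 0) (toℚᵘ-/ j 0))))))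

fromℤ-* : ∀ i j → fromℤ (i ℤ.* j) ≡ fromℤ i * fromℤ j
fromℤ-* i j = sym (/-*-/ i 0 j 0)

fromℤ-neg : ∀ i → fromℤ (ℤ.- i) ≡ - fromℤ i
fromℤ-neg i = toℚᵘ-injective
  (ℚᵘ.≃-trans (toℚᵘ-/ (ℤ.- i) 0)
  (ℚᵘ.≃-sym (ℚᵘ.≃-trans (toℚᵘ-homo‿- (fromℤ i)) (ℚᵘ.-‿cong (toℚᵘ-/ i 0)))))

fromℤ-- : ∀ i j → fromℤ (i ℤ.- j) ≡ fromℤ i - fromℤ j
fromℤ-- i j = trans (fromℤ-+ i (ℤ.- j)) (cong (fromℤ i +_) (fromℤ-neg j))

ι-+ : ∀ m n → ι (m ℕ.+ n) ≡ ι m + ι n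
ι-+ m n = fromℤ-+ (ℤ.+ m) (ℤ.+ n)

-- Only the equation b t = a is wanted, so the denominator is cleared; the form `suc e` makes it
-- visibly positive.
fraction : ∀ q → 0ℚ ≤ q → ∃[ a ] ∃[ e ] ι (suc e) * q ≡ ι a
fraction q@(mkℚ (ℤ.+ a) e _) _ = a , e , toℚᵘ-injective
  (ℚᵘ.≃-trans (toℚᵘ-homo-* (ι (suc e)) q)
  (ℚᵘ.≃-trans (ℚᵘ.*-congʳ {toℚᵘ q} (toℚᵘ-/ (ℤ.+ suc e) 0))
  (ℚᵘ.≃-trans (ℚᵘ.*≡* (trans (ℤ.*-identityʳ (ℤ.+ suc e ℤ.* ℤ.+ a))
    (trans (ℤ.*-comm (ℤ.+ suc e) (ℤ.+ a))
      (cong (λ n → ℤ.+ a ℤ.* ℤ.+ n) (sym (ℕ.*-identityˡ (suc e)))))))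
  (ℚᵘ.≃-sym (toℚᵘ-/ (ℤ.+ a) 0)))))
fraction q@(mkℚ ℤ.-[1+ _ ] _ _) 0≤q with nonNegative {q} 0≤q
... | ()

-- Null sequences

-- `_≃ᵣ_` unfolds to this for the termwise difference, so equalities of reals serve as null
-- sequences unchanged. Limit relations can then be stated on partial sums, without Cauchy proofs.
Null : (ℕ → ℚ) → Set
Null u = ∀ ε → 0ℚ < ε → ∃[ N ] ∀ n → N ℕ.≤ n → ∣ u n ∣ < ε

null-cong : ∀ {u v} → (∀ n → u n ≡ v n) → Null u → Null v
null-cong u≡v h ε 0<ε with h ε 0<ε
... | N , hN = N , λ n N≤n → subst (λ z → ∣ z ∣ < ε) (u≡v n) (hN n N≤n)

null-shift : ∀ {u} → Null u → Null (u ∘ suc)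
null-shift h ε 0<ε with h ε 0<ε
... | N , hN = N , λ n N≤n → hN (suc n) (ℕ.m≤n⇒m≤1+n N≤n)

null-+ : ∀ {u v} → Null u → Null v → Null (λ n → u n + v n)
null-+ {u} {v} hu hv ε 0<ε with hu (half ε) (half-pos 0<ε) | hv (half ε) (half-pos 0<ε)
... | M , hM | N , hN = M ℕ.+ N , λ n ≤n →
  ≤-<-trans (∣p+q∣≤∣p∣+∣q∣ (u n) (v n))
    (subst (∣ u n ∣ + ∣ v n ∣ <_) (half+half ε)
      (+-mono-< (hM n (ℕ.m+n≤o⇒m≤o M ≤n)) (hN n (ℕ.m+n≤o⇒n≤o M ≤n))))

null-* : ∀ {u} c → Null u → Null (λ n → c * u n)
null-* {u} c h ε 0<ε = proj₁ u-small , λ n N≤n →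
  ≤-<-trans (∣*∣≤ {c} {u n} ≤-refl (<⇒≤ (proj₂ u-small n N≤n))) (proj₂ (proj₂ η-data))
  where
  η-data : ∃[ η ] 0ℚ < η × ∣ c ∣ * η < ε
  η-data = shrink (0≤∣p∣ c) 0<ε
  η : ℚ
  η = proj₁ η-data
  u-small : ∃[ N ] ∀ n → N ℕ.≤ n → ∣ u n ∣ < η
  u-small = h η (proj₁ (proj₂ η-data))

-- Terms of the series and their recurrence

-- The quotient is even below 1/2; 5/6 is the ratio that `Geometric` is built for.
*recip≤5/6 : ∀ {a m} → a ℕ.≤ m → ι a * recip (2 ℕ.* m) ≤ 5/6
*recip≤5/6 {a} {m} a≤m = subst (_≤ 5/6)
  (trans (cong (λ z → ℤ.+ (a ℕ.* 1) / suc z) (sym (ℕ.+-identityʳ (2 ℕ.* m))))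
    (trans (cong (_/ (1 ℕ.* d)) (ℤ.pos-* a 1)) (sym (/-*-/ (ℤ.+ a) 0 (ℤ.+ 1) (2 ℕ.* m)))))
  (/-≤-/ (a ℕ.* 1) (2 ℕ.* m) 5 5 (begin
    a ℕ.* 1 ℕ.* 6       ≡⟨ cong (ℕ._* 6) (ℕ.*-identityʳ a) ⟩
    a ℕ.* 6             ≤⟨ ℕ.*-monoˡ-≤ 6 a≤m ⟩
    m ℕ.* 6             ≤⟨ ℕ.m≤m+n (m ℕ.* 6) (m ℕ.* 4 ℕ.+ 5) ⟩
    m ℕ.* 6 ℕ.+ (m ℕ.* 4 ℕ.+ 5)
      ≡⟨ N.solve 1 (λ m → m N.:* N.con 6 N.:+ (m N.:* N.con 4 N.:+ N.con 5)
           N.:= N.con 5 N.:* (N.con 1 N.:+ N.con 2 N.:* m)) refl m ⟩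
    5 ℕ.* d             ∎))
  where
  open ℕ.≤-Reasoning
  module N = ℕ.+-*-Solver
  d = suc (2 ℕ.* m)

module Bessel (t : ℚ) (1≤t : 1ℚ ≤ t) (t≤4 : t ≤ 4ℚ)
              (a e : ℕ) (b*t≡a : ι (suc e) * t ≡ ι a) where

  b : ℕ
  b = suc e

  0≤t : 0ℚ ≤ t
  0≤t = ≤-trans 0≤1 1≤t

  1≤b : 1ℚ ≤ ι b
  1≤b = ι-mono {1} {b} (ℕ.s≤s ℕ.z≤n)

  1≤a : 1ℚ ≤ ι a
  1≤a = subst (1ℚ ≤_) b*t≡a (*-mono-≤-0≤ 0≤1 0≤t 1≤b 1≤t)

  lead : ℕ → ℚ
  lead zero    = 1ℚ
  lead (suc m) = ι a * recip (2 ℕ.* m) * lead m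

  -- V m j = aᵐ tʲ / ((2j)!! (2j + 2m - 1)!!); since recip k is 1 / (k + 1), the
  -- arguments of recip are one less than the factors of the double factorials.
  V : ℕ → ℕ → ℚ
  V m zero    = lead m
  V m (suc j) = t * recip (suc (2 ℕ.* j)) * recip (2 ℕ.* (m ℕ.+ j)) * V m j

  G : ℕ → ℕ → ℚ
  G m = alt (V m)

  -- At m = 0 the denominator is (2j)!! (2j - 1)!! = (2j)!, so `G 0` is the cosine series.
  V-0-mag : ∀ {h} → t ≡ h * h → ∀ j → V 0 j ≡ mag j h
  V-0-mag t≡hh zero = refl
  V-0-mag {h} t≡hh (suc j) = trans
    (cong₂ (λ s v → s * r * r′ * v) t≡hh (V-0-mag t≡hh j))
    (trans (solve 4 (λ h r r′ v → h :* h :* r :* r′ :* v := v :* (h :* h) :* (r :* r′)) refl h r r′ (mag j h))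
      (sym (mag-suc j h)))
    where
    r = recip (suc (2 ℕ.* j))
    r′ = recip (2 ℕ.* j)

  -- `V` is defined by recursion on j; this is the step in m, where the odd double factorial gains
  -- one factor.
  V-sucˡ : ∀ m j → V (suc m) j ≡ ι a * recip (2 ℕ.* (m ℕ.+ j)) * V m j
  V-sucˡ m zero = cong (λ n → ι a * recip (2 ℕ.* n) * lead m) (sym (ℕ.+-identityʳ m))
  V-sucˡ m (suc j) = begin
    t * r * recip (2 ℕ.* suc (m ℕ.+ j)) * V (suc m) j
      ≡⟨ cong₂ (λ n v → t * r * recip (2 ℕ.* n) * v) (sym (ℕ.+-suc m j)) (V-sucˡ m j) ⟩
    t * r * s * (ι a * s′ * V m j)
      ≡⟨ solve 6 (λ t r s a s′ v → t :* r :* s :* (a :* s′ :* v) := a :* s :* (t :* r :* s′ :* v))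
           refl t r s (ι a) s′ (V m j) ⟩
    ι a * s * (t * r * s′ * V m j) ∎
    where
    open ≡-Reasoning
    r = recip (suc (2 ℕ.* j))
    s = recip (2 ℕ.* (m ℕ.+ suc j))
    s′ = recip (2 ℕ.* (m ℕ.+ j))

  a*V : ∀ m j → ι a * V m j ≡ ι (suc (2 ℕ.* (m ℕ.+ j))) * V (suc m) j
  a*V m j = sym (begin
    o * V (suc m) j        ≡⟨ cong (o *_) (V-sucˡ m j) ⟩
    o * (ι a * s * V m j)  ≡⟨ solve 4 (λ o a s v → o :* (a :* s :* v) := o :* s :* (a :* v)) refl o (ι a) s (V m j) ⟩
    o * s * (ι a * V m j)  ≡⟨ cong (_* (ι a * V m j)) (ι*recip (2 ℕ.* (m ℕ.+ j))) ⟩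
    1ℚ * (ι a * V m j)     ≡⟨ *-identityˡ (ι a * V m j) ⟩
    ι a * V m j            ∎)
    where
    open ≡-Reasoning
    o = ι (suc (2 ℕ.* (m ℕ.+ j)))
    s = recip (2 ℕ.* (m ℕ.+ j))

  -- By b t = a, the t gained in passing to j + 1 turns into the a that raises m, while 2j + 2
  -- cancels against the even double factorial.
  b*V : ∀ m j → ι (suc (suc (2 ℕ.* j))) * (ι b * V (suc m) (suc j)) ≡ V (suc (suc m)) j
  b*V m j = begin
    c * (ι b * (t * r * s * v))
      ≡⟨ solve 6 (λ c b t r s v → c :* (b :* (t :* r :* s :* v)) := c :* r :* (b :* t :* s :* v))
           refl c (ι b) t r s v ⟩
    c * r * (ι b * t * s * v)
      ≡⟨ cong₂ (λ x y → x * (y * s * v)) (ι*recip (suc (2 ℕ.* j))) b*t≡a ⟩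
    1ℚ * (ι a * s * v)
      ≡⟨ *-identityˡ (ι a * s * v) ⟩
    ι a * s * v
      ≡⟨ sym (V-sucˡ (suc m) j) ⟩
    V (suc (suc m)) j ∎
    where
    open ≡-Reasoning
    c = ι (suc (suc (2 ℕ.* j)))
    r = recip (suc (2 ℕ.* j))
    s = recip (2 ℕ.* (suc m ℕ.+ j))
    v = V (suc m) j

  -- The first summand is free of j and becomes a coefficient of the recurrence; the second is the
  -- factor that `b*V` cancels.
  odd-split : ∀ m j → ι (suc (2 ℕ.* (m ℕ.+ suc j))) ≡ ι (suc (2 ℕ.* m)) + ι (suc (suc (2 ℕ.* j)))
  odd-split m j = trans
    (cong ι (N.solve 2 (λ m j → N.con 1 N.:+ N.con 2 N.:* (m N.:+ (N.con 1 N.:+ j))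
      N.:= (N.con 1 N.:+ N.con 2 N.:* m) N.:+ (N.con 2 N.:+ N.con 2 N.:* j)) refl m j))
    (ι-+ (suc (2 ℕ.* m)) (suc (suc (2 ℕ.* j))))
    where module N = ℕ.+-*-Solver

  V-rec : ∀ m j → ι b * (ι a * V m (suc j)) - ι b * ι (suc (2 ℕ.* m)) * V (suc m) (suc j)
                  ≡ V (suc (suc m)) j
  V-rec m j = begin
    ι b * (ι a * V m (suc j)) - ι b * o * v
      ≡⟨ cong (λ z → ι b * z - ι b * o * v) (trans (a*V m (suc j)) (cong (_* v) (odd-split m j))) ⟩
    ι b * ((o + c) * v) - ι b * o * v
      ≡⟨ solve 4 (λ b o c v → b :* ((o :+ c) :* v) :- b :* o :* v := c :* (b :* v)) refl (ι b) o c v ⟩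
    c * (ι b * v)
      ≡⟨ b*V m j ⟩
    V (suc (suc m)) j ∎
    where
    open ≡-Reasoning
    o = ι (suc (2 ℕ.* m))
    c = ι (suc (suc (2 ℕ.* j)))
    v = V (suc m) (suc j)

  -- Alternating sum of `V-rec`: its shift in j reverses the signs and sets n terms against n + 1.
  -- The leftover terms at j = 0 cancel by `a*V`, so the identity is exact.
  G-rec : ∀ m n → G (suc (suc m)) n
                  ≡ ι b * ι (suc (2 ℕ.* m)) * G (suc m) (suc n) - ι b * (ι a * G m (suc n))
  G-rec m zero = begin
    0ℚ
      ≡⟨ solve 3 (λ b o l → con 0ℚ := b :* o :* (con 0ℚ :+ con 1ℚ :* l) :- b :* (o :* l)) refl (ι b) o l ⟩
    ι b * o * (0ℚ + 1ℚ * l) - ι b * (o * l)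
      ≡⟨ cong (λ z → ι b * o * (0ℚ + 1ℚ * l) - ι b * z)
           (trans (cong (λ k → ι (suc (2 ℕ.* k)) * l) (sym (ℕ.+-identityʳ m))) (sym (a*V m 0))) ⟩
    ι b * o * (0ℚ + 1ℚ * l) - ι b * (ι a * lead m)
      ≡⟨ solve 5 (λ b o l a k → b :* o :* (con 0ℚ :+ con 1ℚ :* l) :- b :* (a :* k)
           := b :* o :* (con 0ℚ :+ con 1ℚ :* l) :- b :* (a :* (con 0ℚ :+ con 1ℚ :* k)))
           refl (ι b) o l (ι a) (lead m) ⟩
    ι b * o * (0ℚ + 1ℚ * l) - ι b * (ι a * (0ℚ + 1ℚ * lead m)) ∎
    where
    open ≡-Reasoning
    o = ι (suc (2 ℕ.* m))
    l = lead (suc m)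
  G-rec m (suc n) = begin
    G (suc (suc m)) n + s * V (suc (suc m)) n
      ≡⟨ cong₂ (λ x y → x + s * y) (G-rec m n) (sym (V-rec m n)) ⟩
    (ι b * o * g′ - ι b * (ι a * g)) + s * (ι b * (ι a * v) - ι b * o * v′)
      ≡⟨ solve 8 (λ a b o g g′ s v v′ →
           (b :* o :* g′ :- b :* (a :* g)) :+ s :* (b :* (a :* v) :- b :* o :* v′)
           := b :* o :* (g′ :+ (con (- 1ℚ) :* s) :* v′) :- b :* (a :* (g :+ (con (- 1ℚ) :* s) :* v)))
           refl (ι a) (ι b) o g g′ s v v′ ⟩
    ι b * o * G (suc m) (suc (suc n)) - ι b * (ι a * G m (suc (suc n))) ∎
    where
    open ≡-Reasoning
    o = ι (suc (2 ℕ.* m))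
    s = (- 1ℚ) ^ n
    g = G m (suc n)
    g′ = G (suc m) (suc n)
    v = V m (suc n)
    v′ = V (suc m) (suc n)

  -- Bounds on the series

  0<lead : ∀ m → 0ℚ < lead m
  0<lead zero    = from-yes (0ℚ <? 1ℚ)
  0<lead (suc m) = 0<* (0<* (<-≤-trans (from-yes (0ℚ <? 1ℚ)) 1≤a) 0<recip) (0<lead m)
    where
    0<recip : 0ℚ < recip (2 ℕ.* m)
    0<recip = positive⁻¹ (recip (2 ℕ.* m)) {{normalize-pos 1 (suc (2 ℕ.* m))}}

  lead-step : ∀ m → a ℕ.≤ m → lead (suc m) ≤ 5/6 * lead m
  lead-step m a≤m = *-monoʳ-≤-nonNeg (lead m) {{nonNegative (<⇒≤ (0<lead m))}} (*recip≤5/6 a≤m)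

  0≤V : ∀ m j → 0ℚ ≤ V m j
  0≤V m zero    = <⇒≤ (0<lead m)
  0≤V m (suc j) = 0≤* (0≤* (0≤* 0≤t (0≤recip (suc (2 ℕ.* j)))) (0≤recip (2 ℕ.* (m ℕ.+ j)))) (0≤V m j)

  -- The quotient of the two terms is at most 4 · 1/2 · 1/3. In row 0 the last factor would be 1 at
  -- j = 0, hence the row `suc m`.
  V-ratio : ∀ m j → V (suc m) (suc j) ≤ 2/3 * V (suc m) j
  V-ratio m j = *-monoʳ-≤-nonNeg (V (suc m) j) {{nonNegative (0≤V (suc m) j)}}
    (*-mono-≤-0≤ (0≤* 0≤t (0≤recip (suc (2 ℕ.* j)))) (0≤recip 2)
      (*-mono-≤-0≤ 0≤t (0≤recip 1) t≤4 (recip-anti {1} {suc (2 ℕ.* j)} (ℕ.s≤s ℕ.z≤n)))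
      (recip-anti {2} {2 ℕ.* (suc m ℕ.+ j)} (ℕ.*-monoʳ-≤ 2 {1} (ℕ.s≤s ℕ.z≤n))))

  2/3*V≤ : ∀ {c} m j → 2/3 ≤ c → 2/3 * V (suc m) j ≤ c * V (suc m) j
  2/3*V≤ m j = *-monoʳ-≤-nonNeg (V (suc m) j) {{nonNegative (0≤V (suc m) j)}}

  V↓ : ∀ m j → V (suc m) (suc j) ≤ V (suc m) j
  V↓ m j = ≤-trans (V-ratio m j)
    (≤-trans (2/3*V≤ m j (from-yes (2/3 ≤? 1ℚ))) (≤-reflexive (*-identityˡ (V (suc m) j))))

  G-upper : ∀ m n → G (suc m) n ≤ lead (suc m)
  G-upper m n = proj₂ (alt-bounds (V (suc m)) (0≤V (suc m)) (V↓ m) n)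

  -- The alternating sum is at least the difference of its first two terms, of which the ratio 2/3
  -- leaves a third of the first. An empty sum is 0, hence `suc n`.
  G-lower : ∀ m n → 1/3 * lead (suc m) ≤ G (suc m) (suc n)
  G-lower m n = ≤-trans
    (0≤⇒≤ (≤⇒0≤ (V-ratio m 0))
      (solve 2 (λ v w → (v :- w) :- con 1/3 :* v := con 2/3 :* v :- w) refl (V (suc m) 0) (V (suc m) 1)))
    (alt-lower (V (suc m)) (0≤V (suc m)) (V↓ m) n)

  1/3≤G₁ : ∀ n → 1/3 ≤ G 1 (suc n)
  1/3≤G₁ n = ≤-trans (*-monoˡ-≤-nonNeg 1/3 1≤lead₁) (G-lower 0 n)
    where
    1≤lead₁ : 1ℚ ≤ lead 1
    1≤lead₁ = subst (1ℚ ≤_) (solve 1 (λ a → a := a :* con 1ℚ :* con 1ℚ) refl (ι a)) 1≤a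

  private
    module V₁ = Geometric (V 1) 0 (0≤V 1)
      (λ j _ → ≤-trans (V-ratio 0 j) (2/3*V≤ 0 j (from-yes (2/3 ≤? 5/6))))

  -- `G-rec` links partial sums of lengths n and n + 1, so trading `G 1 (suc n)` for `G 1 n` must
  -- cost nothing in the limit.
  G₁-increment-null : Null (λ n → G 1 (suc n) - G 1 n)
  G₁-increment-null ε 0<ε = proj₁ tail-small , λ n N≤n → begin-strict
    ∣ G 1 (suc n) - G 1 n ∣
      ≡⟨ cong ∣_∣ (solve 2 (λ g v → (g :+ v) :- g := v) refl (G 1 n) ((- 1ℚ) ^ n * V 1 n)) ⟩
    ∣ (- 1ℚ) ^ n * V 1 n ∣
      ≡⟨ ∣p*q∣≡∣p∣*∣q∣ ((- 1ℚ) ^ n) (V 1 n) ⟩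
    ∣ (- 1ℚ) ^ n ∣ * ∣ V 1 n ∣
      ≡⟨ cong₂ _*_ (∣-1^∣ n) (0≤p⇒∣p∣≡p (0≤V 1 n)) ⟩
    1ℚ * V 1 n
      -- The 6 is there only because `Geometric.null` controls six times the term.
      ≤⟨ *-monoʳ-≤-nonNeg (V 1 n) {{nonNegative (0≤V 1 n)}} (from-yes (1ℚ ≤? 6ℚ)) ⟩
    6ℚ * V 1 n
      <⟨ proj₂ (proj₂ tail-small) n N≤n ⟩
    ε ∎
    where
    open ≤-Reasoning
    tail-small : ∃[ N ] 0 ℕ.≤ N × (∀ n → N ℕ.≤ n → 6ℚ * V 1 n < ε)
    tail-small = V₁.null 0<ε

  -- Limits as integer multiples

  -- The solution of the recurrence in `G-rec` with initial values 0 and 1. The factor aᵐ in `V` and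
  -- the multiplication by b keep its coefficients integral.
  mult : ℕ → ℤ
  mult 0 = ℤ.+ 0
  mult 1 = ℤ.+ 1
  mult (suc (suc m)) =
    ℤ.+ b ℤ.* ℤ.+ suc (2 ℕ.* m) ℤ.* mult (suc m) ℤ.- ℤ.+ b ℤ.* (ℤ.+ a ℤ.* mult m)

  mult-rec : ∀ m → fromℤ (mult (suc (suc m)))
    ≡ ι b * ι (suc (2 ℕ.* m)) * fromℤ (mult (suc m)) - ι b * (ι a * fromℤ (mult m))
  mult-rec m = trans (fromℤ-- (ℤ.+ b ℤ.* o ℤ.* x) (ℤ.+ b ℤ.* (ℤ.+ a ℤ.* y)))
    (cong₂ _-_
      (trans (fromℤ-* (ℤ.+ b ℤ.* o) x) (cong (_* fromℤ x) (fromℤ-* (ℤ.+ b) o)))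
      (trans (fromℤ-* (ℤ.+ b) (ℤ.+ a ℤ.* y)) (cong (ι b *_) (fromℤ-* (ℤ.+ a) y))))
    where
    o = ℤ.+ suc (2 ℕ.* m)
    x = mult (suc m)
    y = mult m

  module _ (G₀-null : Null (G 0)) where

    G-mult : ∀ m → Null (λ n → G m n - fromℤ (mult m) * G 1 n)
    G-mult 0 = null-cong (λ n → solve 2 (λ g h → g := g :- con 0ℚ :* h) refl (G 0 n) (G 1 n)) G₀-null
    G-mult 1 = null-cong {λ _ → 0ℚ} (λ n → solve 1 (λ g → con 0ℚ := g :- con 1ℚ :* g) refl (G 1 n))
      (λ ε 0<ε → 0 , λ _ _ → 0<ε)
    G-mult (suc (suc m)) = null-cong eq
      -- The hypotheses are taken at n + 1, as `G-rec` demands; the last summand brings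
      -- `G 1 (suc n)` back to `G 1 n`.
      (null-+ (null-+ (null-* (ι b * o) (null-shift (G-mult (suc m))))
                      (null-* (- (ι b * ι a)) (null-shift (G-mult m))))
              (null-* (fromℤ (mult (suc (suc m)))) G₁-increment-null))
      where
      o = ι (suc (2 ℕ.* m))
      x = fromℤ (mult (suc m))
      y = fromℤ (mult m)
      eq : ∀ n →
        (ι b * o * (G (suc m) (suc n) - x * G 1 (suc n)) + - (ι b * ι a) * (G m (suc n) - y * G 1 (suc n)))
          + fromℤ (mult (suc (suc m))) * (G 1 (suc n) - G 1 n)
        ≡ G (suc (suc m)) n - fromℤ (mult (suc (suc m))) * G 1 n
      eq n rewrite G-rec m n | mult-rec m =
        solve 9 (λ a b o x y g g′ h h′ →
          (b :* o :* (g :- x :* h) :+ :- (b :* a) :* (g′ :- y :* h))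
            :+ (b :* o :* x :- b :* (a :* y)) :* (h :- h′)
          := (b :* o :* g :- b :* (a :* g′)) :- (b :* o :* x :- b :* (a :* y)) :* h′)
          refl (ι a) (ι b) o x y (G (suc m) (suc n)) (G m (suc n)) (G 1 (suc n)) (G 1 n)

  -- Impossibility of integer multiples

  -- Since nonempty sums `G 1` are positive, subtracting c times them cannot bring `G (suc m)` below
  -- its own positive lower bound γ.
  ¬nonpositive-multiple : ∀ m {c} → c ≤ 0ℚ → ¬ Null (λ n → G (suc m) n - c * G 1 n)
  ¬nonpositive-multiple m {c} c≤0 h = <-irrefl refl (begin-strict
    γ                ≤⟨ G-lower m N ⟩
    g                ≤⟨ 0≤⇒≤ (0≤* (≤⇒0≤ c≤0) (≤-trans (from-yes (0ℚ ≤? 1/3)) (1/3≤G₁ N)))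
                          (solve 3 (λ g c g₁ → (g :- c :* g₁) :- g := (con 0ℚ :- c) :* g₁) refl g c g₁) ⟩
    g - c * g₁       ≤⟨ p≤∣p∣ (g - c * g₁) ⟩
    -- Evaluated at `suc N`, since both lower bounds concern nonempty sums.
    ∣ g - c * g₁ ∣   <⟨ proj₂ close (suc N) (ℕ.n≤1+n N) ⟩
    γ                ∎)
    where
    open ≤-Reasoning
    γ : ℚ
    γ = 1/3 * lead (suc m)
    close : ∃[ N ] ∀ n → N ℕ.≤ n → ∣ G (suc m) n - c * G 1 n ∣ < γ
    close = h γ (0<* (from-yes (0ℚ <? 1/3)) (0<lead (suc m)))
    N : ℕ
    N = proj₁ close
    g g₁ : ℚ
    g = G (suc m) (suc N)
    g₁ = G 1 (suc N)

  -- For nonempty sums c G₁ is at least 1/3, while `G (suc m)` is at most its leading term, hence at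
  -- most 1/6; a gap of 1/6 remains.
  ¬large-multiple : ∀ m {c} → 6ℚ * lead (suc m) ≤ 1ℚ → 1ℚ ≤ c →
                    ¬ Null (λ n → G (suc m) n - c * G 1 n)
  ¬large-multiple m {c} small 1≤c h = <-irrefl refl (begin-strict
    1/6
      ≤⟨ 0≤⇒≤ (0≤+ (0≤+ (0≤+ (≤⇒0≤ (1/3≤G₁ N))
                              (0≤* (≤⇒0≤ 1≤c) (≤-trans (from-yes (0ℚ ≤? 1/3)) (1/3≤G₁ N))))
                        (0≤* (from-yes (0ℚ ≤? 1/6)) (≤⇒0≤ small)))
                   (≤⇒0≤ (G-upper m (suc N))))
           (solve 4 (λ c g₁ g l → (c :* g₁ :- g) :- con 1/6
             := ((g₁ :- con 1/3) :+ (c :- con 1ℚ) :* g₁) :+ con 1/6 :* (con 1ℚ :- con 6ℚ :* l) :+ (l :- g))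
             refl c g₁ g (lead (suc m))) ⟩
    c * g₁ - g       ≤⟨ p≤∣p∣ (c * g₁ - g) ⟩
    ∣ c * g₁ - g ∣   ≡⟨ ∣-∣-sym (c * g₁) g ⟩
    ∣ g - c * g₁ ∣   <⟨ proj₂ close (suc N) (ℕ.n≤1+n N) ⟩
    1/6              ∎)
    where
    open ≤-Reasoning
    close : ∃[ N ] ∀ n → N ℕ.≤ n → ∣ G (suc m) n - c * G 1 n ∣ < 1/6
    close = h 1/6 (from-yes (0ℚ <? 1/6))
    N : ℕ
    N = proj₁ close
    g g₁ : ℚ
    g = G (suc m) (suc N)
    g₁ = G 1 (suc N)

  -- Integrality enters here: every integer is at most 0 or at least 1.
  ¬integer-multiple : ∀ m → 6ℚ * lead (suc m) ≤ 1ℚ → ∀ i →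
                      ¬ Null (λ n → G (suc m) n - fromℤ i * G 1 n)
  ¬integer-multiple m small (ℤ.+ zero)  = ¬nonpositive-multiple m ≤-refl
  ¬integer-multiple m small (ℤ.+ suc k) = ¬large-multiple m small (ι-mono {1} {suc k} (ℕ.s≤s ℕ.z≤n))
  ¬integer-multiple m small ℤ.-[1+ k ]  = ¬nonpositive-multiple m (neg-antimono-≤ (0≤ι (suc k)))

  private
    module Lead = Geometric lead a (λ m → <⇒≤ (0<lead m)) lead-step

  G₀-not-null : ¬ Null (G 0)
  G₀-not-null G₀-null =
    -- `Lead.null` at ε = 1 supplies just the bound 6 `lead` < 1 from m on.
    ¬integer-multiple m (<⇒≤ (proj₂ (proj₂ lead-null) (suc m) (ℕ.n≤1+n m)))
      (mult (suc m)) (G-mult G₀-null (suc m))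
    where
    lead-null : ∃[ N ] a ℕ.≤ N × (∀ n → N ℕ.≤ n → 6ℚ * lead n < 1ℚ)
    lead-null = Lead.null (from-yes (0ℚ <? 1ℚ))
    m : ℕ
    m = proj₁ lead-null

-- From the cosine at a rational to π

cos-rational-not-null : ∀ {h} → InRange h → ¬ Null (λ n → cosSum n h)
cos-rational-not-null {h} (1≤h , h≤2) cos-null =
  B.G₀-not-null (null-cong cosSum≡G₀ cos-null)
  where
  0≤h : 0ℚ ≤ h
  0≤h = ≤-trans 0≤1 1≤h
  t-fraction : ∃[ a ] ∃[ e ] ι (suc e) * (h * h) ≡ ι a
  t-fraction = fraction (h * h) (0≤* 0≤h 0≤h)
  module B = Bessel (h * h) (*-mono-≤-0≤ 0≤1 0≤h 1≤h 1≤h) (*-mono-≤-0≤ 0≤h 0≤2 h≤2 h≤2)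
    (proj₁ t-fraction) (proj₁ (proj₂ t-fraction)) (proj₂ (proj₂ t-fraction))
  alt-cong : ∀ {U W} → (∀ k → U k ≡ W k) → ∀ n → alt U n ≡ alt W n
  alt-cong eq zero    = refl
  alt-cong eq (suc n) = cong₂ (λ x y → x + (- 1ℚ) ^ n * y) (alt-cong eq n) (eq n)
  cosSum≡G₀ : ∀ n → cosSum n h ≡ B.G 0 n
  cosSum≡G₀ n = trans (cosSum-alt n h) (alt-cong (λ j → sym (B.V-0-mag refl j)) n)

≤-limit : ∀ {p q} → (∀ ε → 0ℚ < ε → p < q + ε) → p ≤ q
≤-limit {p} {q} h = ≮⇒≥ λ q<p → <-irrefl refl
  (subst (p <_) (solve 2 (λ p q → q :+ (p :- q) := p) refl p q)
    (h (p - q) (subst (_< p - q) (+-inverseʳ q) (+-monoˡ-< (- q) q<p))))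

-- Non-strict bounds survive the limit; h in [1, 2] is what gives 1 ≤ h² ≤ 4.
halfπ-limit-range : ∀ {h} → halfπ ≃ᵣ fromℚ h → InRange h
halfπ-limit-range {h} halfπ≃h = ≤-limit lower , ≤-limit upper
  where
  module _ (ε : ℚ) (0<ε : 0ℚ < ε) where
    close : ∃[ N ] ∀ n → N ℕ.≤ n → ∣ halfπ-seq n - h ∣ < ε
    close = halfπ≃h ε 0<ε
    N : ℕ
    N = proj₁ close
    s : ℚ
    s = halfπ-seq N
    s-h<ε : ∣ s - h ∣ < ε
    s-h<ε = proj₂ close N ℕ.≤-refl
    lower : 1ℚ < h + ε
    lower = ≤-<-trans (proj₁ (halfπ-range N))
      (subst (_< h + ε) (solve 2 (λ h s → h :+ (s :- h) := s) refl h s)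
        (+-monoʳ-< h (≤-<-trans (p≤∣p∣ (s - h)) s-h<ε)))
    upper : h < 2ℚ + ε
    upper = subst (_< 2ℚ + ε) (solve 2 (λ h s → s :+ (h :- s) := h) refl h s)
      (+-mono-≤-< (proj₂ (halfπ-range N))
        (≤-<-trans (p≤∣p∣ (h - s)) (subst (_< ε) (∣-∣-sym s h) s-h<ε)))

halfπ-irrational : Irrational halfπ
halfπ-irrational (h , halfπ≃h) = cos-rational-not-null (halfπ-limit-range halfπ≃h)
  -- The first summand is null by continuity of the cosine, the second because `halfπ` is a zero of
  -- it.
  (null-cong {λ n → (cosSum n h - cosSum n (halfπ-seq n)) + (cosSum n (halfπ-seq n) - 0ℚ)}
    (λ n → solve 2 (λ c d → (c :- d) :+ (d :- con 0ℚ) := c) refl (cosSum n h) (cosSum n (halfπ-seq n)))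
    (null-+ {λ n → cosSum n h - cosSum n (halfπ-seq n)} {λ n → cosSum n (halfπ-seq n) - 0ℚ}
      cos-close cos-halfπ))
  where
  cos-close : Null (λ n → cosSum n h - cosSum n (halfπ-seq n))
  -- `cos-cong` yields the opposite difference, hence the factor -1.
  cos-close = null-cong {λ n → - 1ℚ * (cosSum n (halfπ-seq n) - cosSum n h)}
    (λ n → solve 2 (λ c d → con (- 1ℚ) :* (d :- c) := c :- d) refl (cosSum n h) (cosSum n (halfπ-seq n)))
    (null-* {λ n → cosSum n (halfπ-seq n) - cosSum n h} (- 1ℚ) (cos-cong {halfπ} {fromℚ h} halfπ≃h))

theorem2 : Irrational π
theorem2 (q , π≃q) = halfπ-irrational (½ * q ,
  -- `π` is termwise twice `halfπ-seq`, so halving its distance to q gives that of `halfπ` to q / 2.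
  null-cong {λ n → ½ * ((halfπ-seq n + halfπ-seq n) - q)}
    (λ n → solve 2 (λ s q → con ½ :* ((s :+ s) :- q) := s :- con ½ :* q) refl (halfπ-seq n) q)
    (null-* {λ n → (halfπ-seq n + halfπ-seq n) - q} ½ π≃q))
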